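{- Let $S_n$ and $s_n$ denote the large and small Schröder numbers, and let $A134425[n]$, $A225887[n]$, $A114710[n]$ ($n\ge 0$) be the integer sequences defined in the context. For a tuple $v=(v_1,\ldots,v_n)$ of nonnegative integers write $\widetilde v=v_1+2v_2+\cdots+nv_n$, $|v|=v_1+\cdots+v_n$ and $\binom{|v|}{v_1,\ldots,v_n}=\frac{|v|!}{v_1!\cdots v_n!}$. Then the following formulas hold for all $n\ge 1$, unless stated otherwise, where each sum is over all tuples $v=(v_1,\ldots,v_n)$ of nonnegative integers with $\widetilde v=n$: \begin{align*} \sum_{\widetilde v=n}(-1)^{|v|-1}\binom{|v|}{v_1,\ldots,v_n}S_1^{v_1}S_2^{v_2}\cdots S_n^{v_n}&=S_{n-1}\quad(n\ge2),\\ \sum_{\widetilde v=n}\binom{|v|}{v_1,\ldots,v_n}S_1^{v_1}S_2^{v_2}\cdots S_n^{v_n}&=2\cdot A134425[n-1],\\ \sum_{\widetilde v=n}(-1)^{|v|-1}\binom{|v|}{v_1,\ldots,v_n}S_0^{v_1}S_1^{v_2}\cdots S_{n-1}^{v_n}&=s_{n-1},\\ \sum_{\widetilde v=n}\binom{|v|}{v_1,\ldots,v_n}S_0^{v_1}S_1^{v_2}\cdots S_{n-1}^{v_n}&=s_n,\\ \sum_{\widetilde v=n}(-1)^{|v|-1}\binom{|v|}{v_1,\ldots,v_n}s_1^{v_1}s_2^{v_2}\cdots s_n^{v_n}&=S_{n-1},\\ \sum_{\widetilde v=n}\binom{|v|}{v_1,\ldots,v_n}s_1^{v_1}s_2^{v_2}\cdots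 s_n^{v_n}&=A225887[n-1],\\ \sum_{\widetilde v=n}(-1)^{|v|-1}\binom{|v|}{v_1,\ldots,v_n}s_0^{v_1}s_1^{v_2}\cdots s_{n-1}^{v_n}&=A114710[n-1],\\ \sum_{\widetilde v=n}\binom{|v|}{v_1,\ldots,v_n}s_0^{v_1}s_1^{v_2}\cdots s_{n-1}^{v_n}&=S_{n-1},\\ \sum_{\widetilde v=n}(-1)^{|v|-1}\binom{|v|}{v_1,\ldots,v_n}s_2^{v_1}s_3^{v_2}\cdots s_{n+1}^{v_n}&=S_{n-1}\quad(n\ge2). \end{align*}
   Context: Large Schröder numbers: $S_0=1$ and $S_n=\frac1n\sum_{k=1}^n 2^k\binom nk\binom n{k-1}$ for $n\ge 1$. Small Schröder numbers: $s_0=1$ and $s_n=\frac12 S_n$ for $n\ge1$. Schröder paths: for $n\ge0$, $\mathcal P_n$ is the set of lattice paths from $(0,0)$ to $(2n,0)$ with steps $u=(1,1)$, $d=(1,-1)$, $h=(2,0)$ that never go below the $x$-axis ($\mathcal P_0$ consists of the empty path only). A low $h$ step is an $h$ step lying on the $x$-axis; $\mathrm{low}(\lambda)$ denotes the number of low $h$ steps of $\lambda$. A peak of height $1$ is a $u$ step ending at height $1$ immediately followed by a $d$ step. OEIS sequences ($n\ge 0$): $A134425[n]=\sum_{\lambda\in\mathcal P_n}4^{\mathrm{low}(\lambda)}$ (Schröder paths whose low $h$ steps come in four kinds); $A225887[n]=\sum_{\lambda\in\mathcal P_n}3^{\mathrm{low}(\lambda)}$ (Schröder paths whose low $h$ steps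 come in three colors); $A114710[n]$ is the number of $\lambda\in\mathcal P_n$ having no low $h$ steps and no peaks of height $1$. -}

module Defs where

open import Algebra.Bundles using (CommutativeRing)
open import Data.Empty using (⊥)
open import Data.Fin.Base using (Fin; zero; suc; toℕ)
open import Data.Integer.Base using (+_)
open import Data.List.Base as List using (List; []; _∷_; _++_; length; filter; upTo; applyUpTo; cartesianProductWith)
open import Data.List.Membership.Propositional using (_∈_)
open import Data.List.Membership.Propositional.Properties using (∈-filter⁺; ∈-filter⁻; ∈-cartesianProductWith⁺; ∈-upTo⁺; ∈-map⁺; ∈-map⁻; ∈-++⁺ˡ; ∈-++⁺ʳ; ∈-++⁻)
open import Data.List.Relation.Unary.All using ([])
open import Data.List.Relation.Unary.AllPairs using ([]; _∷_)
open import Data.List.Relation.Unary.Any using (here)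
open import Data.List.Relation.Unary.Unique.Propositional using (Unique)
import Data.List.Relation.Unary.Unique.Propositional.Properties as Uniq
open import Data.Nat.Base using (ℕ; zero; suc; _+_; _*_; _∸_; _^_; _!; _≤_; s≤s; NonZero)
open import Data.Nat.Combinatorics using (_C_)
open import Data.Nat.ListAction using (sum)
open import Data.Nat.Properties using (_≟_; _!≢0; m*n≢0; m≤m+n; m≤n+m; m≤n*m; ≤-trans)
open import Data.Product.Base using (_,_; proj₂)
open import Data.Rational.Base as ℚ using (ℚ; 0ℚ; 1ℚ; ½)
open import Data.Rational.Properties using (+-*-commutativeRing; *-1-monoid)
open import Data.Sum.Base using (inj₁; inj₂)
open import Data.Vec.Base as Vec using (Vec; []; _∷_; lookup; tabulate)
open import Data.Vec.Properties using (∷-injective)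
open import Function.Base using (_∘_)
open import Relation.Binary.PropositionalEquality using (_≡_; refl)
open import Relation.Nullary.Decidable using (_×-dec_)

open import Algebra.Properties.Semiring.Exp (CommutativeRing.semiring +-*-commutativeRing) public
  using () renaming (_^_ to _^ℚ_)
open import Algebra.Properties.Monoid.Sum *-1-monoid public
  using () renaming (sum to ∏)

fromℕ : ℕ → ℚ
fromℕ n = + n ℚ./ 1

-- The divisions by n and by 2 are taken in ℚ, so no truncation is involved.
S : ℕ → ℚ
S zero      = 1ℚ
S n@(suc _) = + sum (List.map (λ k → 2 ^ k * (n C k) * (n C (k ∸ 1))) (applyUpTo suc n)) ℚ./ n

s : ℕ → ℚ
s zero      = 1ℚ
s n@(suc _) = ½ ℚ.* S n

-- Path y l: paths with steps u = (1,1), d = (1,-1), h = (2,0) that start at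
-- height y, never go below height 0, and end at height 0 after a total
-- horizontal displacement l.
infixr 5 u∷_ d∷_ h∷_
data Path : ℕ → ℕ → Set where
  []  : Path 0 0
  u∷_ : ∀ {y l} → Path (suc y) l → Path y (suc l)
  d∷_ : ∀ {y l} → Path y l → Path (suc y) (suc l)
  h∷_ : ∀ {y l} → Path y l → Path y (suc (suc l))

low : ∀ {y l} → Path y l → ℕ
low []             = 0
low (u∷ p)         = low p
low (d∷ p)         = low p
low {zero}  (h∷ p) = suc (low p)
low {suc _} (h∷ p) = low p

-- The number of peaks of height 1.
hills : ∀ {y l} → Path y l → ℕ
hills []                  = 0
hills {zero}  (u∷ (d∷ p)) = suc (hills p)
hills {zero}  (u∷ (u∷ p)) = hills (u∷ p)
hills {zero}  (u∷ (h∷ p)) = hills (h∷ p)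
hills {suc _} (u∷ p)      = hills p
hills (d∷ p)              = hills p
hills (h∷ p)              = hills p

mutual
  paths : ∀ y l → List (Path y l)
  paths y       (suc l) = List.map u∷_ (paths (suc y) l) ++ (pathsD y l ++ pathsH y l)
  paths zero    zero    = [] ∷ []
  paths (suc y) zero    = []

  pathsD : ∀ y l → List (Path y (suc l))
  pathsD zero    l = []
  pathsD (suc y) l = List.map d∷_ (paths y l)

  pathsH : ∀ y l → List (Path y (suc l))
  pathsH y zero    = []
  pathsH y (suc l) = List.map h∷_ (paths y l)

paths-complete : ∀ {y l} (p : Path y l) → p ∈ paths y l
paths-complete []     = here refl
paths-complete {y} {suc l} (u∷ p) = ∈-++⁺ˡ (∈-map⁺ u∷_ (paths-complete p))
paths-complete {suc y} {suc l} (d∷ p) =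
  ∈-++⁺ʳ (List.map u∷_ (paths (suc (suc y)) l)) (∈-++⁺ˡ (∈-map⁺ d∷_ (paths-complete p)))
paths-complete {y} {suc (suc l)} (h∷ p) =
  ∈-++⁺ʳ (List.map u∷_ (paths (suc y) (suc l))) (∈-++⁺ʳ (pathsD y (suc l)) (∈-map⁺ h∷_ (paths-complete p)))

d≢h : ∀ y l {p} → p ∈ pathsD y l → p ∈ pathsH y l → ⊥
d≢h (suc y) (suc l) i j with ∈-map⁻ d∷_ i | ∈-map⁻ h∷_ j
... | _ , _ , refl | _ , _ , ()

u≢dh : ∀ y l {p} → p ∈ List.map u∷_ (paths (suc y) l) → p ∈ pathsD y l ++ pathsH y l → ⊥
u≢dh y l i j with ∈-map⁻ u∷_ i | ∈-++⁻ (pathsD y l) j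
u≢dh (suc y) l i j | _ , _ , refl | inj₁ k with ∈-map⁻ d∷_ k
... | _ , _ , ()
u≢dh y (suc l) i j | _ , _ , refl | inj₂ k with ∈-map⁻ h∷_ k
... | _ , _ , ()

mutual
  paths-unique : ∀ y l → Unique (paths y l)
  paths-unique y       (suc l) = Uniq.++⁺ (Uniq.map⁺ (λ { refl → refl }) (paths-unique (suc y) l))
    (Uniq.++⁺ (pathsD-unique y l) (pathsH-unique y l) (λ (i , j) → d≢h y l i j))
    (λ (i , j) → u≢dh y l i j)
  paths-unique zero    zero    = [] ∷ []
  paths-unique (suc y) zero    = []

  pathsD-unique : ∀ y l → Unique (pathsD y l)
  pathsD-unique zero    l = []
  pathsD-unique (suc y) l = Uniq.map⁺ (λ { refl → refl }) (paths-unique y l)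

  pathsH-unique : ∀ y l → Unique (pathsH y l)
  pathsH-unique y zero    = []
  pathsH-unique y (suc l) = Uniq.map⁺ (λ { refl → refl }) (paths-unique y l)

𝒫 : ∀ n → List (Path 0 (2 * n))
𝒫 n = paths 0 (2 * n)

A134425 : ℕ → ℕ
A134425 n = sum (List.map (λ p → 4 ^ low p) (𝒫 n))

A225887 : ℕ → ℕ
A225887 n = sum (List.map (λ p → 3 ^ low p) (𝒫 n))

A114710 : ℕ → ℕ
A114710 n = length (filter (λ p → (low p ≟ 0) ×-dec (hills p ≟ 0)) (𝒫 n))

-- v = (v₁, …, vₘ) is stored with v_{i+1} at index i, so weight v = v₁ + 2v₂ + … + mvₘ.
weight : ∀ {m} → Vec ℕ m → ℕ
weight v = Vec.sum (tabulate (λ i → suc (toℕ i) * lookup v i))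

size : ∀ {m} → Vec ℕ m → ℕ
size = Vec.sum

factorials : ∀ {m} → Vec ℕ m → ℕ
factorials = Vec.foldr′ (λ k r → k ! * r) 1

factorials≢0 : ∀ {m} (v : Vec ℕ m) → NonZero (factorials v)
factorials≢0 []      = _
factorials≢0 (k ∷ v) = m*n≢0 (k !) (factorials v) {{k !≢0}} {{factorials≢0 v}}

multinomial : ∀ {m} → Vec ℕ m → ℚ
multinomial v = (+ (size v !) ℚ./ factorials v) {{factorials≢0 v}}

-- powersFrom k a (v₁, …, vₘ) = a_k^{v₁} a_{k+1}^{v₂} ⋯ a_{k+m-1}^{vₘ}
powersFrom : ∀ {m} → ℕ → (ℕ → ℚ) → Vec ℕ m → ℚ
powersFrom k a v = ∏ (λ i → a (k + toℕ i) ^ℚ lookup v i)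

boundedTuples : (m b : ℕ) → List (Vec ℕ m)
boundedTuples zero    b = [] ∷ []
boundedTuples (suc m) b = cartesianProductWith _∷_ (upTo (suc b)) (boundedTuples m b)

-- Every entry of a tuple of weight w is at most w, so this lists all tuples of
-- weight w, each once: see the next three lemmas.
tuples : (m w : ℕ) → List (Vec ℕ m)
tuples m w = filter (λ v → weight v ≟ w) (boundedTuples m w)

tuples-sound : ∀ {m w} {v : Vec ℕ m} → v ∈ tuples m w → weight v ≡ w
tuples-sound {m} {w} i = proj₂ (∈-filter⁻ (λ v → weight v ≟ w) {xs = boundedTuples m w} i)

tuples-complete : ∀ {m w} (v : Vec ℕ m) → weight v ≡ w → v ∈ tuples m w
tuples-complete {w = w} v refl = ∈-filter⁺ (λ v′ → weight v′ ≟ w) (bounded v λ i → entry≤weight v i) refl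
  where
  bounded : ∀ {m b} (v : Vec ℕ m) → (∀ i → lookup v i ≤ b) → v ∈ boundedTuples m b
  bounded []      _ = here refl
  bounded (k ∷ v) f = ∈-cartesianProductWith⁺ _∷_ (∈-upTo⁺ (s≤s (f zero))) (bounded v (f ∘ suc))

  term≤sum : ∀ {m} (f : Fin m → ℕ) i → f i ≤ Vec.sum (tabulate f)
  term≤sum f zero    = m≤m+n _ _
  term≤sum f (suc i) = ≤-trans (term≤sum (f ∘ suc) i) (m≤n+m _ (f zero))

  entry≤weight : ∀ {m} (v : Vec ℕ m) i → lookup v i ≤ weight v
  entry≤weight v i = ≤-trans (m≤n*m (lookup v i) (suc (toℕ i)))
    (term≤sum (λ j → suc (toℕ j) * lookup v j) i)

tuples-unique : ∀ m w → Unique (tuples m w)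
tuples-unique m w = Uniq.filter⁺ (λ v → weight v ≟ w) (go m)
  where
  go : ∀ m → Unique (boundedTuples m w)
  go zero    = [] ∷ []
  go (suc m) = Uniq.cartesianProductWith⁺ _∷_ ∷-injective (Uniq.upTo⁺ (suc w)) (go m)

infix 8 ∑[weight≡_]_
∑[weight≡_]_ : ∀ n → (Vec ℕ n → ℚ) → ℚ
∑[weight≡ n ] f = List.foldr ℚ._+_ 0ℚ (List.map f (tuples n n))

-- (-1)^{|v|-1}; the truncated subtraction differs from |v| - 1 only when |v| = 0,
-- which does not occur for a tuple of positive weight.
sign : ∀ {m} → Vec ℕ m → ℚ
sign v = (ℚ.- 1ℚ) ^ℚ (size v ∸ 1)

module Submission where

open import Algebra.Bundles using (CommutativeRing)
import Algebra.Construct.Pointwise as Pointwise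
import Algebra.Solver.Ring as RingSolving
open import Algebra.Solver.Ring.AlmostCommutativeRing using (AlmostCommutativeRing; fromCommutativeRing; _-Raw-AlmostCommutative⟶_)
open import Data.Fin.Base using (toℕ)
import Data.Integer.Base as ℤ
open import Data.Integer.Base using () renaming (+_ to pos)
import Data.Integer.Properties as ℤ
open import Data.List.Base as List using (List; []; _∷_; _++_; applyUpTo; cartesianProductWith; filter; length; upTo)
open import Data.Maybe.Base using (Maybe)
open import Data.Nat.Base as ℕ using (ℕ; zero; suc; 2+; _∸_; _!; _≤_; _<_; _≥_; z≤n; s≤s; NonZero)
open import Data.Nat.Combinatorics using (_C_; k>n⇒nCk≡0; nC1≡n; nCk+nC[k+1]≡[n+1]C[k+1])
open import Data.Nat.ListAction using (sum)
import Data.Nat.Properties as ℕ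
import Data.Nat.Tactic.RingSolver as ℕ-Tactic
open import Data.Product.Base using (_×_; _,_)
open import Data.Rational.Base as ℚ using (ℚ; 0ℚ; 1ℚ; ½; _+_; _*_; -_)
import Data.Rational.Properties as ℚ
import Data.Rational.Unnormalised.Base as ℚᵘ
import Data.Rational.Unnormalised.Properties as ℚᵘ
open import Data.Sum.Base using (inj₁; inj₂)
open import Data.Vec.Base as Vec using (Vec; []; _∷_; lookup; tabulate)
open import Defs
open import Function.Base using (_∘_; id; it)
open import Level using (0ℓ)
open import Relation.Binary.PropositionalEquality using (_≡_; _≢_; _≗_; refl; sym; trans; cong; cong₂; module ≡-Reasoning)
open import Relation.Nullary using (¬_; yes; no; contradiction)
open import Relation.Nullary.Decidable using (dec⇒maybe; map′; _×-dec_)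
open import Relation.Unary using (Decidable)
open import Tactic.RingSolver using (solve-∀)
import Tactic.RingSolver.Core.AlmostCommutativeRing as Tactic

open ≡-Reasoning

-- The multinomial sum over the tuples of weight n is the sum over the compositions of n, so with a = a₁ + a₂ x + ⋯
-- the sums of weight n + 1 are the coefficients of the series R with R = a (1 + x R), or R = a (1 - x R) with signs.
-- The nine identities are thus identities between power series, all consequences of S = 1 + x (S + S²).
--
-- With M(a, b) the coefficient of x^b in ((1 + x) / (1 - x))^a, the formula for the Schröder numbers amounts to
-- S_n = M(n+1, n) - M(n, n+1). The differences M(n+j, n) - M(n, n+j) satisfy w_{j+1} = w_j + x (w_{j+1} + w_{j+2}),
-- and so do the generating functions w_j of paths from height j down to 0, split by their first step. Any solution
-- of this recursion satisfies w_{i+j} = S^i w_j; applied to the differences themselves it gives the equation of S,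
-- and applied to paths it gives the equations of the three path series.

-- Formal power series

ℚ-ring : Tactic.AlmostCommutativeRing 0ℓ 0ℓ
ℚ-ring = Tactic.fromCommutativeRing ℚ.+-*-commutativeRing (λ p → dec⇒maybe (0ℚ ℚ.≟ p))

Series : Set
Series = ℕ → ℚ

infixl 6 _⊕_
infixl 7 _⋆_
infixl 6 _⊖_
infix  8 ⊝_

_⊕_ : Series → Series → Series
(f ⊕ g) n = f n + g n

⊝_ : Series → Series
(⊝ f) n = - f n

_⊖_ : Series → Series → Series
f ⊖ g = f ⊕ ⊝ g

-- The Cauchy product, through the decomposition f = f 0 + x (`f ∘ suc`) of the left factor alone;
-- the proofs below are inductions on the degree with that factor generalised.
_⋆_ : Series → Series → Series
(f ⋆ g) zero    = f 0 * g 0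
(f ⋆ g) (suc n) = f 0 * g (suc n) + (f ∘ suc ⋆ g) n

const : ℚ → Series
const c zero    = c
const c (suc n) = 0ℚ

⋆-cong : ∀ {f f′ g g′} → f ≗ f′ → g ≗ g′ → f ⋆ g ≗ f′ ⋆ g′
⋆-cong p q zero    = cong₂ _*_ (p 0) (q 0)
⋆-cong p q (suc n) = cong₂ _+_ (cong₂ _*_ (p 0) (q (suc n))) (⋆-cong (p ∘ suc) q n)

-- The mirror image of the defining recursion, peeling the right factor; commutativity follows by
-- matching the two.
⋆-suc : ∀ f g n → (f ⋆ g) (suc n) ≡ f (suc n) * g 0 + (f ⋆ g ∘ suc) n
⋆-suc f g zero    = ℚ.+-comm (f 0 * g 1) (f 1 * g 0)
⋆-suc f g (suc n) = begin
  f 0 * g (2+ n) + (f ∘ suc ⋆ g) (suc n)                            ≡⟨ cong (f 0 * g (2+ n) +_) (⋆-suc (f ∘ suc) g n) ⟩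
  f 0 * g (2+ n) + (f (2+ n) * g 0 + (f ∘ suc ⋆ g ∘ suc) n)         ≡⟨ swap (f 0 * g (2+ n)) (f (2+ n) * g 0) _ ⟩
  f (2+ n) * g 0 + (f 0 * g (2+ n) + (f ∘ suc ⋆ g ∘ suc) n)         ∎
  where
  swap : ∀ a b c → a + (b + c) ≡ b + (a + c)
  swap = solve-∀ ℚ-ring

⋆-comm : ∀ f g → f ⋆ g ≗ g ⋆ f
⋆-comm f g zero    = ℚ.*-comm (f 0) (g 0)
⋆-comm f g (suc n) = trans
  (cong₂ _+_ (ℚ.*-comm (f 0) (g (suc n))) (⋆-comm (f ∘ suc) g n))
  (sym (⋆-suc g f n))

⋆-distribʳ-⊕ : ∀ h f g → (f ⊕ g) ⋆ h ≗ f ⋆ h ⊕ g ⋆ h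
⋆-distribʳ-⊕ h f g zero    = ℚ.*-distribʳ-+ (h 0) (f 0) (g 0)
⋆-distribʳ-⊕ h f g (suc n) = trans
  (cong ((f 0 + g 0) * h (suc n) +_) (⋆-distribʳ-⊕ h (f ∘ suc) (g ∘ suc) n))
  (rearrange (f 0) (g 0) (h (suc n)) ((f ∘ suc ⋆ h) n) ((g ∘ suc ⋆ h) n))
  where
  rearrange : ∀ a b c x y → (a + b) * c + (x + y) ≡ (a * c + x) + (b * c + y)
  rearrange = solve-∀ ℚ-ring

⋆-distribˡ-⊕ : ∀ h f g → h ⋆ (f ⊕ g) ≗ h ⋆ f ⊕ h ⋆ g
⋆-distribˡ-⊕ h f g n = begin
  (h ⋆ (f ⊕ g)) n          ≡⟨ ⋆-comm h (f ⊕ g) n ⟩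
  ((f ⊕ g) ⋆ h) n          ≡⟨ ⋆-distribʳ-⊕ h f g n ⟩
  (f ⋆ h) n + (g ⋆ h) n    ≡⟨ cong₂ _+_ (⋆-comm f h n) (⋆-comm g h n) ⟩
  (h ⋆ f) n + (h ⋆ g) n    ∎

scale-⋆ : ∀ c f g → (λ n → c * f n) ⋆ g ≗ λ n → c * (f ⋆ g) n
scale-⋆ c f g zero    = ℚ.*-assoc c (f 0) (g 0)
scale-⋆ c f g (suc n) = trans
  (cong (c * f 0 * g (suc n) +_) (scale-⋆ c (f ∘ suc) g n))
  (factor c (f 0) (g (suc n)) _)
  where
  factor : ∀ c x y z → c * x * y + c * z ≡ c * (x * y + z)
  factor = solve-∀ ℚ-ring

⋆-assoc : ∀ f g h → (f ⋆ g) ⋆ h ≗ f ⋆ (g ⋆ h)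
⋆-assoc f g h zero    = ℚ.*-assoc (f 0) (g 0) (h 0)
⋆-assoc f g h (suc n) = begin
  f 0 * g 0 * h (suc n) + (((λ k → f 0 * g (suc k)) ⊕ f ∘ suc ⋆ g) ⋆ h) n
    ≡⟨ cong (f 0 * g 0 * h (suc n) +_) (⋆-distribʳ-⊕ h (λ k → f 0 * g (suc k)) (f ∘ suc ⋆ g) n) ⟩
  f 0 * g 0 * h (suc n) + (((λ k → f 0 * g (suc k)) ⋆ h) n + ((f ∘ suc ⋆ g) ⋆ h) n)
    ≡⟨ cong (f 0 * g 0 * h (suc n) +_) (cong₂ _+_ (scale-⋆ (f 0) (g ∘ suc) h n) (⋆-assoc (f ∘ suc) g h n)) ⟩
  f 0 * g 0 * h (suc n) + (f 0 * (g ∘ suc ⋆ h) n + (f ∘ suc ⋆ (g ⋆ h)) n)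
    ≡⟨ factor (f 0) (g 0) (h (suc n)) ((g ∘ suc ⋆ h) n) _ ⟩
  f 0 * (g 0 * h (suc n) + (g ∘ suc ⋆ h) n) + (f ∘ suc ⋆ (g ⋆ h)) n ∎
  where
  factor : ∀ x y z u v → x * y * z + (x * u + v) ≡ x * (y * z + u) + v
  factor = solve-∀ ℚ-ring

0-⋆ : ∀ f n → ((λ _ → 0ℚ) ⋆ f) n ≡ 0ℚ
0-⋆ f zero    = ℚ.*-zeroˡ (f 0)
0-⋆ f (suc n) = cong₂ _+_ (ℚ.*-zeroˡ (f (suc n))) (0-⋆ f n)

const-⋆ : ∀ c f n → (const c ⋆ f) n ≡ c * f n
const-⋆ c f zero    = refl
const-⋆ c f (suc n) = trans (cong (c * f (suc n) +_) (0-⋆ f n)) (ℚ.+-identityʳ (c * f (suc n)))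

series-commutativeRing : CommutativeRing 0ℓ 0ℓ
series-commutativeRing = record
  { Carrier = Series
  ; _≈_     = _≗_
  ; _+_     = _⊕_
  ; _*_     = _⋆_
  ; -_      = ⊝_
  ; 0#      = λ _ → 0ℚ
  ; 1#      = const 1ℚ
  ; isCommutativeRing = record
    { isRing = record
      { +-isAbelianGroup = Pointwise.isAbelianGroup ℕ ℚ.+-0-isAbelianGroup
      ; *-cong           = ⋆-cong
      ; *-assoc          = ⋆-assoc
      ; *-identity       = ⋆-identityˡ , λ f n → trans (⋆-comm f (const 1ℚ) n) (⋆-identityˡ f n)
      ; distrib          = ⋆-distribˡ-⊕ , ⋆-distribʳ-⊕
      }
    ; *-comm = ⋆-comm
    }
  }
  where
  ⋆-identityˡ : ∀ f → const 1ℚ ⋆ f ≗ f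
  ⋆-identityˡ f n = trans (const-⋆ 1ℚ f n) (ℚ.*-identityˡ (f n))

series-ring : AlmostCommutativeRing 0ℓ 0ℓ
series-ring = fromCommutativeRing series-commutativeRing

-- Makes ℚ the coefficient ring of the solver, so that series identities may contain constants such
-- as ½.
const-morphism : CommutativeRing.rawRing ℚ.+-*-commutativeRing -Raw-AlmostCommutative⟶ series-ring
const-morphism = record
  { ⟦_⟧    = const
  ; +-homo = λ { _ _ zero → refl ; _ _ (suc _) → refl }
  ; *-homo = λ { _ _ zero → refl ; c d (suc n) → sym (trans (const-⋆ c (const d) (suc n)) (ℚ.*-zeroʳ c)) }
  ; -‿homo = λ { _ zero → refl ; _ (suc _) → refl }
  ; 0-homo = λ { zero → refl ; (suc _) → refl }
  ; 1-homo = λ _ → refl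
  }

const-≟ : ∀ c d → Maybe (const c ≗ const d)
const-≟ c d = dec⇒maybe (map′ (λ { refl _ → refl }) (λ p → p 0) (c ℚ.≟ d))

module SeriesSolver = RingSolving (CommutativeRing.rawRing ℚ.+-*-commutativeRing) series-ring const-morphism const-≟
open SeriesSolver using (_:+_; _:*_; _:-_; :-_; _:=_; con) renaming (solve to series-solve)

X : Series
X zero    = 0ℚ
X (suc n) = const 1ℚ n

X⋆-zero : ∀ f → (X ⋆ f) 0 ≡ 0ℚ
X⋆-zero f = ℚ.*-zeroˡ (f 0)

X⋆-suc : ∀ f n → (X ⋆ f) (suc n) ≡ f n
X⋆-suc f n = begin
  0ℚ * f (suc n) + (const 1ℚ ⋆ f) n   ≡⟨ cong₂ _+_ (ℚ.*-zeroˡ (f (suc n))) (const-⋆ 1ℚ f n) ⟩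
  0ℚ + 1ℚ * f n                       ≡⟨ ℚ.+-identityˡ (1ℚ * f n) ⟩
  1ℚ * f n                            ≡⟨ ℚ.*-identityˡ (f n) ⟩
  f n                                 ∎

-- Finite sums of rationals

fromℚᵘ-homo-* : ∀ p q → ℚ.fromℚᵘ (p ℚᵘ.* q) ≡ ℚ.fromℚᵘ p * ℚ.fromℚᵘ q
fromℚᵘ-homo-* p q = ℚ.toℚᵘ-injective (ℚᵘ.≃-trans (ℚ.toℚᵘ-fromℚᵘ (p ℚᵘ.* q)) (ℚᵘ.≃-sym
  (ℚᵘ.≃-trans (ℚ.toℚᵘ-homo-* (ℚ.fromℚᵘ p) (ℚ.fromℚᵘ q)) (ℚᵘ.*-cong (ℚ.toℚᵘ-fromℚᵘ p) (ℚ.toℚᵘ-fromℚᵘ q)))))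

fromℚᵘ-homo-+ : ∀ p q → ℚ.fromℚᵘ (p ℚᵘ.+ q) ≡ ℚ.fromℚᵘ p + ℚ.fromℚᵘ q
fromℚᵘ-homo-+ p q = ℚ.toℚᵘ-injective (ℚᵘ.≃-trans (ℚ.toℚᵘ-fromℚᵘ (p ℚᵘ.+ q)) (ℚᵘ.≃-sym
  (ℚᵘ.≃-trans (ℚ.toℚᵘ-homo-+ (ℚ.fromℚᵘ p) (ℚ.fromℚᵘ q)) (ℚᵘ.+-cong (ℚ.toℚᵘ-fromℚᵘ p) (ℚ.toℚᵘ-fromℚᵘ q)))))

/-*-/ : ∀ i m j n .{{_ : NonZero m}} .{{_ : NonZero n}} .{{_ : NonZero (m ℕ.* n)}} →
  (pos (i ℕ.* j)) ℚ./ (m ℕ.* n) ≡ (pos i ℚ./ m) * (pos j ℚ./ n)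
/-*-/ i (suc m) j (suc n) = trans (ℚ./-cong (ℤ.pos-* i j) refl) (fromℚᵘ-homo-* (ℚᵘ.mkℚᵘ (pos i) m) (ℚᵘ.mkℚᵘ (pos j) n))

fromℕ-+ : ∀ m n → fromℕ (m ℕ.+ n) ≡ fromℕ m + fromℕ n
fromℕ-+ m n = trans
  (ℚ./-cong (trans (ℤ.pos-+ m n) (sym (cong₂ ℤ._+_ (ℤ.*-identityʳ (pos m)) (ℤ.*-identityʳ (pos n))))) refl)
  (fromℚᵘ-homo-+ (ℚᵘ.mkℚᵘ (pos m) 0) (ℚᵘ.mkℚᵘ (pos n) 0))

fromℕ-* : ∀ m n → fromℕ (m ℕ.* n) ≡ fromℕ m * fromℕ n
fromℕ-* m n = /-*-/ m 1 n 1

recip : ∀ n .{{_ : NonZero n}} → ℚ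
recip n = pos 1 ℚ./ n

/≡*recip : ∀ m n .{{_ : NonZero n}} → pos m ℚ./ n ≡ fromℕ m * recip n
/≡*recip m n = trans (ℚ./-cong {{it}} {{nz}} (cong pos (sym (ℕ.*-identityʳ m))) (sym (ℕ.*-identityˡ n))) (/-*-/ m 1 1 n {{it}} {{it}} {{nz}})
  where
  nz : NonZero (1 ℕ.* n)
  nz = ℕ.m*n≢0 1 n

fromℕ*recip : ∀ n .{{_ : NonZero n}} → fromℕ n * recip n ≡ 1ℚ
fromℕ*recip n@(suc n-1) = trans (sym (/≡*recip n n)) (ℚ.fromℚᵘ-cong {ℚᵘ.mkℚᵘ (pos n) n-1} {ℚᵘ.1ℚᵘ} (ℚᵘ.*≡* (ℤ.*-comm (pos n) (pos 1))))

invFactorial : ℕ → ℚ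
invFactorial n = recip (n !) {{n ℕ.!≢0}}

invFactorial-suc : ∀ n → fromℕ (suc n) * invFactorial (suc n) ≡ invFactorial n
invFactorial-suc n = begin
  fromℕ (suc n) * invFactorial (suc n)
    ≡⟨ cong (fromℕ (suc n) *_) (/-*-/ 1 (suc n) 1 (n !) {{_}} {{n ℕ.!≢0}} {{suc n ℕ.!≢0}}) ⟩
  fromℕ (suc n) * (recip (suc n) * invFactorial n)   ≡⟨ ℚ.*-assoc (fromℕ (suc n)) (recip (suc n)) (invFactorial n) ⟨
  fromℕ (suc n) * recip (suc n) * invFactorial n     ≡⟨ cong (_* invFactorial n) (fromℕ*recip (suc n)) ⟩
  1ℚ * invFactorial n                                ≡⟨ ℚ.*-identityˡ (invFactorial n) ⟩
  invFactorial n                                     ∎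

-- Sums over lists and over initial segments of ℕ

∑ : ∀ {A : Set} → List A → (A → ℚ) → ℚ
∑ xs f = List.foldr _+_ 0ℚ (List.map f xs)

∑-cong : ∀ {A : Set} (xs : List A) {f g} → f ≗ g → ∑ xs f ≡ ∑ xs g
∑-cong []       e = refl
∑-cong (x ∷ xs) e = cong₂ _+_ (e x) (∑-cong xs e)

∑-++ : ∀ {A : Set} (xs ys : List A) f → ∑ (xs ++ ys) f ≡ ∑ xs f + ∑ ys f
∑-++ []       ys f = sym (ℚ.+-identityˡ (∑ ys f))
∑-++ (x ∷ xs) ys f = trans (cong (f x +_) (∑-++ xs ys f)) (sym (ℚ.+-assoc (f x) (∑ xs f) (∑ ys f)))

∑-map : ∀ {A B : Set} (h : A → B) xs f → ∑ (List.map h xs) f ≡ ∑ xs (f ∘ h)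
∑-map h []       f = refl
∑-map h (x ∷ xs) f = cong (f (h x) +_) (∑-map h xs f)

∑-*ˡ : ∀ {A : Set} c (xs : List A) f → ∑ xs (λ x → c * f x) ≡ c * ∑ xs f
∑-*ˡ c []       f = sym (ℚ.*-zeroʳ c)
∑-*ˡ c (x ∷ xs) f = trans (cong (c * f x +_) (∑-*ˡ c xs f)) (sym (ℚ.*-distribˡ-+ c (f x) (∑ xs f)))

∑-cartesianProductWith : ∀ {A B C : Set} (h : A → B → C) xs ys f →
  ∑ (cartesianProductWith h xs ys) f ≡ ∑ xs (λ x → ∑ ys (λ y → f (h x y)))
∑-cartesianProductWith h []       ys f = refl
∑-cartesianProductWith h (x ∷ xs) ys f = trans
  (∑-++ (List.map (h x) ys) (cartesianProductWith h xs ys) f)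
  (cong₂ _+_ (∑-map (h x) ys f) (∑-cartesianProductWith h xs ys f))

∑< : ℕ → (ℕ → ℚ) → ℚ
∑< zero    f = 0ℚ
∑< (suc n) f = f 0 + ∑< n (f ∘ suc)

∑-applyUpTo : ∀ {A : Set} (g : ℕ → A) n f → ∑ (applyUpTo g n) f ≡ ∑< n (f ∘ g)
∑-applyUpTo g zero    f = refl
∑-applyUpTo g (suc n) f = cong (f (g 0) +_) (∑-applyUpTo (g ∘ suc) n f)

∑<-cong : ∀ n {f g} → f ≗ g → ∑< n f ≡ ∑< n g
∑<-cong zero    e = refl
∑<-cong (suc n) e = cong₂ _+_ (e 0) (∑<-cong n (e ∘ suc))

∑<-zero : ∀ n {f} → (∀ i → f i ≡ 0ℚ) → ∑< n f ≡ 0ℚ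
∑<-zero zero    e = refl
∑<-zero (suc n) e = cong₂ _+_ (e 0) (∑<-zero n (e ∘ suc))

∑<-+ : ∀ n f g → ∑< n (λ i → f i + g i) ≡ ∑< n f + ∑< n g
∑<-+ zero    f g = refl
∑<-+ (suc n) f g = trans (cong (f 0 + g 0 +_) (∑<-+ n (f ∘ suc) (g ∘ suc))) (interchange (f 0) (g 0) _ _)
  where
  interchange : ∀ a b c d → a + b + (c + d) ≡ a + c + (b + d)
  interchange = solve-∀ ℚ-ring

∑<-*ˡ : ∀ c n f → ∑< n (λ i → c * f i) ≡ c * ∑< n f
∑<-*ˡ c zero    f = sym (ℚ.*-zeroʳ c)
∑<-*ˡ c (suc n) f = trans (cong (c * f 0 +_) (∑<-*ˡ c n (f ∘ suc))) (sym (ℚ.*-distribˡ-+ c (f 0) _))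

∑<-swap : ∀ m n (f : ℕ → ℕ → ℚ) → ∑< m (λ i → ∑< n (f i)) ≡ ∑< n (λ j → ∑< m (λ i → f i j))
∑<-swap zero    n f = sym (∑<-zero n (λ _ → refl))
∑<-swap (suc m) n f = trans (cong (∑< n (f 0) +_) (∑<-swap m n (f ∘ suc))) (sym (∑<-+ n (f 0) (λ j → ∑< m (λ i → f (suc i) j))))

∑<-last : ∀ n f → ∑< (suc n) f ≡ ∑< n f + f n
∑<-last zero    f = ℚ.+-comm (f 0) 0ℚ
∑<-last (suc n) f = trans (cong (f 0 +_) (∑<-last n (f ∘ suc))) (sym (ℚ.+-assoc (f 0) (∑< n (f ∘ suc)) (f (suc n))))

-- Structural recursion makes `δ (suc i ℕ.+ w) (suc n)` reduce to `δ (i ℕ.+ w) n`, so that removing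
-- a part from a composition shifts the degree by computation alone.
δ : ℕ → ℕ → ℚ
δ zero    zero    = 1ℚ
δ zero    (suc n) = 0ℚ
δ (suc m) zero    = 0ℚ
δ (suc m) (suc n) = δ m n

δ-refl : ∀ n → δ n n ≡ 1ℚ
δ-refl zero    = refl
δ-refl (suc n) = δ-refl n

δ-≢ : ∀ {m n} → m ≢ n → δ m n ≡ 0ℚ
δ-≢ {zero}  {zero}  m≢n = contradiction refl m≢n
δ-≢ {zero}  {suc n} m≢n = refl
δ-≢ {suc m} {zero}  m≢n = refl
δ-≢ {suc m} {suc n} m≢n = δ-≢ (m≢n ∘ cong suc)

-- Trades a filter for a 0/1 factor that can be absorbed into the summand. It serves both the weight
-- condition on tuples and the restriction on paths in `A114710`.
∑-filter : ∀ {A : Set} {P : A → Set} (P? : Decidable P) (c : A → ℚ) → (∀ x → P x → c x ≡ 1ℚ) → (∀ x → ¬ P x → c x ≡ 0ℚ) →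
  ∀ xs f → ∑ (filter P? xs) f ≡ ∑ xs (λ x → c x * f x)
∑-filter P? c c≡1 c≡0 []       f = refl
∑-filter P? c c≡1 c≡0 (x ∷ xs) f with P? x
... | yes Px = begin
  f x + ∑ (filter P? xs) f               ≡⟨ cong (f x +_) (∑-filter P? c c≡1 c≡0 xs f) ⟩
  f x + ∑ xs (λ x → c x * f x)           ≡⟨ cong (_+ ∑ xs (λ x → c x * f x)) (ℚ.*-identityˡ (f x)) ⟨
  1ℚ * f x + ∑ xs (λ x → c x * f x)      ≡⟨ cong (λ q → q * f x + ∑ xs (λ x → c x * f x)) (c≡1 x Px) ⟨
  c x * f x + ∑ xs (λ x → c x * f x)     ∎
... | no ¬Px = begin
  ∑ (filter P? xs) f                     ≡⟨ ∑-filter P? c c≡1 c≡0 xs f ⟩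
  ∑ xs (λ x → c x * f x)                 ≡⟨ ℚ.+-identityˡ _ ⟨
  0ℚ + ∑ xs (λ x → c x * f x)            ≡⟨ cong (_+ ∑ xs (λ x → c x * f x)) (trans (cong (_* f x) (c≡0 x ¬Px)) (ℚ.*-zeroˡ (f x))) ⟨
  c x * f x + ∑ xs (λ x → c x * f x)     ∎

-- Sums over tuples

*-swap : ∀ p q r → p * (q * r) ≡ q * (p * r)
*-swap = solve-∀ ℚ-ring

dividedPower : ℚ → ℕ → ℚ
dividedPower x k = x ^ℚ k * invFactorial k

dividedPowers : ∀ {m} → Series → Vec ℕ m → ℚ
dividedPowers a []      = 1ℚ
dividedPowers a (k ∷ v) = dividedPower (a 0) k * dividedPowers (a ∘ suc) v

-- The denominators vᵢ! are distributed over the powers aᵢ^vᵢ; only |v|! still couples the entries.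
multinomial*powers : ∀ {m} (a : Series) (v : Vec ℕ m) →
  multinomial v * ∏ (λ i → a (toℕ i) ^ℚ lookup v i) ≡ fromℕ (size v !) * dividedPowers a v
multinomial*powers a v = begin
  multinomial v * powers a v
    ≡⟨ cong (_* powers a v) (/≡*recip (size v !) (factorials v) {{factorials≢0 v}}) ⟩
  fromℕ (size v !) * recip (factorials v) {{factorials≢0 v}} * powers a v
    ≡⟨ ℚ.*-assoc (fromℕ (size v !)) (recip (factorials v) {{factorials≢0 v}}) (powers a v) ⟩
  fromℕ (size v !) * (recip (factorials v) {{factorials≢0 v}} * powers a v)
    ≡⟨ cong (fromℕ (size v !) *_) (recip*powers a v) ⟩
  fromℕ (size v !) * dividedPowers a v ∎
  where
  powers : ∀ {m} → Series → Vec ℕ m → ℚ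
  powers a v = ∏ (λ i → a (toℕ i) ^ℚ lookup v i)

  interchange : ∀ p q r s → p * q * (r * s) ≡ r * p * (q * s)
  interchange = solve-∀ ℚ-ring

  recip*powers : ∀ {m} a (v : Vec ℕ m) → recip (factorials v) {{factorials≢0 v}} * powers a v ≡ dividedPowers a v
  recip*powers a []      = refl
  recip*powers a (k ∷ v) = begin
    recip (k ! ℕ.* factorials v) {{factorials≢0 (k ∷ v)}} * (a 0 ^ℚ k * powers (a ∘ suc) v)
      ≡⟨ cong (_* (a 0 ^ℚ k * powers (a ∘ suc) v)) (/-*-/ 1 (k !) 1 (factorials v) {{k ℕ.!≢0}} {{factorials≢0 v}} {{factorials≢0 (k ∷ v)}}) ⟩
    invFactorial k * recip (factorials v) {{factorials≢0 v}} * (a 0 ^ℚ k * powers (a ∘ suc) v)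
      ≡⟨ interchange (invFactorial k) (recip (factorials v) {{factorials≢0 v}}) (a 0 ^ℚ k) (powers (a ∘ suc) v) ⟩
    dividedPower (a 0) k * (recip (factorials v) {{factorials≢0 v}} * powers (a ∘ suc) v)
      ≡⟨ cong (dividedPower (a 0) k *_) (recip*powers (a ∘ suc) v) ⟩
    dividedPower (a 0) k * dividedPowers (a ∘ suc) v ∎

-- Arbitrary position weights keep the family closed under dropping the first entry, which replaces
-- `g` by `g ∘ suc`; `weightBy suc` is `weight`.
weightBy : ∀ {m} → (ℕ → ℕ) → Vec ℕ m → ℕ
weightBy g v = Vec.sum (tabulate (λ i → g (toℕ i) ℕ.* lookup v i))

size≡0⇒weightBy≡0 : ∀ {m} g (v : Vec ℕ m) → size v ≡ 0 → weightBy g v ≡ 0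
size≡0⇒weightBy≡0 g []         _ = refl
size≡0⇒weightBy≡0 g (zero ∷ v) e = cong₂ ℕ._+_ (ℕ.*-zeroʳ (g 0)) (size≡0⇒weightBy≡0 (g ∘ suc) v e)

shift : ℕ → ℕ → (ℕ → ℕ → ℚ) → ℕ → ℕ → ℚ
shift k l φ r w = φ (k ℕ.+ r) (l ℕ.+ w)

-- The sum of φ |v| (∑ g(i) vᵢ) ∏ aᵢ^vᵢ / vᵢ! over all v in {0,…,b}^m; see ∑-boundedTuples.
moment : ℕ → ℕ → (ℕ → ℕ) → Series → (ℕ → ℕ → ℚ) → ℚ
moment b zero    g a φ = φ 0 0
moment b (suc m) g a φ =
  ∑< (suc b) (λ k → dividedPower (a 0) k * moment b m (g ∘ suc) (a ∘ suc) (shift k (g 0 ℕ.* k) φ))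

∑-boundedTuples : ∀ b m g a φ →
  ∑ (boundedTuples m b) (λ v → φ (size v) (weightBy g v) * dividedPowers a v) ≡ moment b m g a φ
∑-boundedTuples b zero    g a φ = trans (ℚ.+-identityʳ (φ 0 0 * 1ℚ)) (ℚ.*-identityʳ (φ 0 0))
∑-boundedTuples b (suc m) g a φ = begin
  ∑ (boundedTuples (suc m) b) f
    ≡⟨ ∑-cartesianProductWith _∷_ (upTo (suc b)) (boundedTuples m b) f ⟩
  ∑ (upTo (suc b)) (λ k → ∑ (boundedTuples m b) (λ v → f (k ∷ v)))
    ≡⟨ ∑-applyUpTo id (suc b) (λ k → ∑ (boundedTuples m b) (λ v → f (k ∷ v))) ⟩
  ∑< (suc b) (λ k → ∑ (boundedTuples m b) (λ v → f (k ∷ v)))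
    ≡⟨ ∑<-cong (suc b) (λ k → trans (∑-cong (boundedTuples m b) (λ v → *-swap (shifted k v) (dividedPower (a 0) k) (dividedPowers (a ∘ suc) v)))
         (trans (∑-*ˡ (dividedPower (a 0) k) (boundedTuples m b) (λ v → shifted k v * dividedPowers (a ∘ suc) v))
           (cong (dividedPower (a 0) k *_) (∑-boundedTuples b m (g ∘ suc) (a ∘ suc) (shift k (g 0 ℕ.* k) φ))))) ⟩
  moment b (suc m) g a φ ∎
  where
  f : Vec ℕ (suc m) → ℚ
  f v = φ (size v) (weightBy g v) * dividedPowers a v

  shifted : ℕ → Vec ℕ m → ℚ
  shifted k v = φ (k ℕ.+ size v) (g 0 ℕ.* k ℕ.+ weightBy (g ∘ suc) v)

moment-cong : ∀ b m g a {φ ψ} → (∀ r w → φ r w ≡ ψ r w) → moment b m g a φ ≡ moment b m g a ψ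
moment-cong b zero    g a e = e 0 0
moment-cong b (suc m) g a e = ∑<-cong (suc b) (λ k → cong (dividedPower (a 0) k *_)
  (moment-cong b m (g ∘ suc) (a ∘ suc) (λ r w → e (k ℕ.+ r) (g 0 ℕ.* k ℕ.+ w))))

moment-+ : ∀ b m g a φ ψ → moment b m g a (λ r w → φ r w + ψ r w) ≡ moment b m g a φ + moment b m g a ψ
moment-+ b zero    g a φ ψ = refl
moment-+ b (suc m) g a φ ψ = trans
  (∑<-cong (suc b) (λ k → trans
    (cong (dividedPower (a 0) k *_) (moment-+ b m (g ∘ suc) (a ∘ suc) (shift k (g 0 ℕ.* k) φ) (shift k (g 0 ℕ.* k) ψ)))
    (ℚ.*-distribˡ-+ (dividedPower (a 0) k) (inner φ k) (inner ψ k))))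
  (∑<-+ (suc b) (λ k → dividedPower (a 0) k * inner φ k) (λ k → dividedPower (a 0) k * inner ψ k))
  where
  inner : (ℕ → ℕ → ℚ) → ℕ → ℚ
  inner φ k = moment b m (g ∘ suc) (a ∘ suc) (shift k (g 0 ℕ.* k) φ)

moment-*ˡ : ∀ b m g a c φ → moment b m g a (λ r w → c * φ r w) ≡ c * moment b m g a φ
moment-*ˡ b zero    g a c φ = refl
moment-*ˡ b (suc m) g a c φ = trans
  (∑<-cong (suc b) (λ k → trans
    (cong (dividedPower (a 0) k *_) (moment-*ˡ b m (g ∘ suc) (a ∘ suc) c (shift k (g 0 ℕ.* k) φ)))
    (*-swap (dividedPower (a 0) k) c (inner k))))
  (∑<-*ˡ c (suc b) (λ k → dividedPower (a 0) k * inner k))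
  where
  inner : ℕ → ℚ
  inner k = moment b m (g ∘ suc) (a ∘ suc) (shift k (g 0 ℕ.* k) φ)

moment-zero : ∀ b m g a {φ} → (∀ r w → φ r w ≡ 0ℚ) → moment b m g a φ ≡ 0ℚ
moment-zero b zero    g a e = e 0 0
moment-zero b (suc m) g a e = ∑<-zero (suc b) (λ k → trans
  (cong (dividedPower (a 0) k *_) (moment-zero b m (g ∘ suc) (a ∘ suc) (λ r w → e (k ℕ.+ r) (g 0 ℕ.* k ℕ.+ w))))
  (ℚ.*-zeroʳ (dividedPower (a 0) k)))

-- All position weights `suc ∘ h` are positive, so any nonzero entry makes the weight positive and
-- only the zero tuple survives.
moment-origin : ∀ b m h a φ → (∀ r w → φ r (suc w) ≡ 0ℚ) → moment b m (suc ∘ h) a φ ≡ φ 0 0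
moment-origin b zero    h a φ e = refl
moment-origin b (suc m) h a φ e = begin
  1ℚ * moment b m (suc ∘ h ∘ suc) (a ∘ suc) (λ r w → φ r (h 0 ℕ.* 0 ℕ.+ w)) + ∑< b _
    ≡⟨ cong₂ _+_
         (trans (ℚ.*-identityˡ _) (trans (moment-origin b m (h ∘ suc) (a ∘ suc) _ vanish₀) (cong (φ 0) (trans (ℕ.+-identityʳ (h 0 ℕ.* 0)) (ℕ.*-zeroʳ (h 0))))))
         (∑<-zero b (λ k → trans (cong (dividedPower (a 0) (suc k) *_) (moment-zero b m (suc ∘ h ∘ suc) (a ∘ suc) (λ r w → e (suc k ℕ.+ r) _))) (ℚ.*-zeroʳ (dividedPower (a 0) (suc k))))) ⟩
  φ 0 0 + 0ℚ  ≡⟨ ℚ.+-identityʳ (φ 0 0) ⟩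
  φ 0 0 ∎
  where
  vanish₀ : ∀ r w → φ r (h 0 ℕ.* 0 ℕ.+ suc w) ≡ 0ℚ
  vanish₀ r w = trans (cong (φ r) (ℕ.+-suc (h 0 ℕ.* 0) w)) (e r _)

dividedPower-suc : ∀ x k → fromℕ (suc k) * dividedPower x (suc k) ≡ x * dividedPower x k
dividedPower-suc x k = begin
  fromℕ (suc k) * (x * x ^ℚ k * invFactorial (suc k))    ≡⟨ rearrange (fromℕ (suc k)) x (x ^ℚ k) (invFactorial (suc k)) ⟩
  x * (x ^ℚ k * (fromℕ (suc k) * invFactorial (suc k)))  ≡⟨ cong (λ q → x * (x ^ℚ k * q)) (invFactorial-suc k) ⟩
  x * dividedPower x k ∎
  where
  rearrange : ∀ p q r s → p * (q * r * s) ≡ q * (r * (p * s))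
  rearrange = solve-∀ ℚ-ring

-- Multiplying by |v| = ∑ vᵢ acts as a derivation: vᵢ aᵢ^vᵢ / vᵢ! = aᵢ · aᵢ^(vᵢ-1) / (vᵢ-1)!,
-- so that lowering vᵢ by one shifts |v| by 1 and the weight by that of vᵢ.
moment-size : ∀ b m h a ψ → (∀ r w → b < w → ψ r w ≡ 0ℚ) →
  moment b m (suc ∘ h) a (λ r w → fromℕ r * ψ r w) ≡
  ∑< m (λ i → a i * moment b m (suc ∘ h) a (shift 1 (suc (h i)) ψ))
moment-size b zero    h a ψ vanish = ℚ.*-zeroˡ (ψ 0 0)
moment-size b (suc m) h a ψ vanish = begin
  ∑< (suc b) (λ k → p k * M (λ r w → fromℕ (k ℕ.+ r) * shifted k r w))
    -- The size is the first entry k plus the size r of the tail; the two summands become `first`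
    -- and `rest`.
    ≡⟨ ∑<-cong (suc b) (λ k → trans
         (cong (p k *_) (trans
           (trans (moment-cong b m g′ a′ (λ r w → trans (cong (_* shifted k r w) (fromℕ-+ k r)) (ℚ.*-distribʳ-+ (shifted k r w) (fromℕ k) (fromℕ r))))
             (moment-+ b m g′ a′ (λ r w → fromℕ k * shifted k r w) (λ r w → fromℕ r * shifted k r w)))
           (cong (_+ M (λ r w → fromℕ r * shifted k r w)) (moment-*ˡ b m g′ a′ (fromℕ k) (shifted k)))))
         (expand (p k) (fromℕ k) (M (shifted k)) _)) ⟩
  ∑< (suc b) (λ k → fromℕ k * p k * M (shifted k) + p k * M (λ r w → fromℕ r * shifted k r w))
    ≡⟨ ∑<-+ (suc b) (λ k → fromℕ k * p k * M (shifted k)) (λ k → p k * M (λ r w → fromℕ r * shifted k r w)) ⟩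
  ∑< (suc b) (λ k → fromℕ k * p k * M (shifted k)) + ∑< (suc b) (λ k → p k * M (λ r w → fromℕ r * shifted k r w))
    ≡⟨ cong₂ _+_ first rest ⟩
  a 0 * moment b (suc m) (suc ∘ h) a (shift 1 (suc (h 0)) ψ) + ∑< m (λ i → a (suc i) * moment b (suc m) (suc ∘ h) a (shift 1 (suc (h (suc i))) ψ)) ∎
  where
  g′ : ℕ → ℕ
  g′ = suc ∘ h ∘ suc

  a′ : Series
  a′ = a ∘ suc

  M : (ℕ → ℕ → ℚ) → ℚ
  M = moment b m g′ a′

  p : ℕ → ℚ
  p = dividedPower (a 0)

  shifted : ℕ → ℕ → ℕ → ℚ
  shifted k = shift k (suc (h 0) ℕ.* k) ψ

  expand : ∀ p q x y → p * (q * x + y) ≡ q * p * x + p * y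
  expand = solve-∀ ℚ-ring

  lower : ∀ k → M (shifted (suc k)) ≡ M (shift k (suc (h 0) ℕ.* k) (shift 1 (suc (h 0)) ψ))
  lower k = moment-cong b m g′ a′ (λ r w → cong (ψ (suc k ℕ.+ r)) (arith (h 0) k w))
    where
    arith : ∀ h k w → suc h ℕ.* suc k ℕ.+ w ≡ suc h ℕ.+ (suc h ℕ.* k ℕ.+ w)
    arith = ℕ-Tactic.solve-∀

  -- Lowering the first entry takes k = 1, ..., b to 0, ..., b - 1, but the target sum runs up to b.
  -- The missing term comes from k = b + 1; its weight exceeds b, so it may be added as zero.
  top : M (shifted (suc b)) ≡ 0ℚ
  top = moment-zero b m g′ a′ (λ r w → vanish _ _ (ℕ.≤-trans (ℕ.m≤n*m (suc b) (suc (h 0))) (ℕ.m≤m+n _ w)))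

  raised : ℕ → ℚ
  raised k = fromℕ (suc k) * p (suc k) * M (shifted (suc k))

  first : ∑< (suc b) (λ k → fromℕ k * p k * M (shifted k)) ≡ a 0 * moment b (suc m) (suc ∘ h) a (shift 1 (suc (h 0)) ψ)
  first = begin
    fromℕ 0 * p 0 * M (shifted 0) + ∑< b raised  ≡⟨ cong (_+ ∑< b raised) (ℚ.*-zeroˡ (M (shifted 0))) ⟩
    0ℚ + ∑< b raised                             ≡⟨ ℚ.+-comm 0ℚ (∑< b raised) ⟩
    ∑< b raised + 0ℚ
      ≡⟨ cong (∑< b raised +_) (trans (cong (fromℕ (suc b) * p (suc b) *_) top) (ℚ.*-zeroʳ (fromℕ (suc b) * p (suc b)))) ⟨
    ∑< b raised + raised b                       ≡⟨ ∑<-last b raised ⟨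
    ∑< (suc b) raised
      ≡⟨ ∑<-cong (suc b) (λ k → trans (cong₂ _*_ (dividedPower-suc (a 0) k) (lower k)) (ℚ.*-assoc (a 0) (p k) _)) ⟩
    ∑< (suc b) (λ k → a 0 * (p k * M (shift k (suc (h 0) ℕ.* k) (shift 1 (suc (h 0)) ψ))))
      ≡⟨ ∑<-*ˡ (a 0) (suc b) (λ k → p k * M (shift k (suc (h 0) ℕ.* k) (shift 1 (suc (h 0)) ψ))) ⟩
    a 0 * moment b (suc m) (suc ∘ h) a (shift 1 (suc (h 0)) ψ) ∎

  rest : ∑< (suc b) (λ k → p k * M (λ r w → fromℕ r * shifted k r w)) ≡
         ∑< m (λ i → a (suc i) * moment b (suc m) (suc ∘ h) a (shift 1 (suc (h (suc i))) ψ))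
  rest = begin
    ∑< (suc b) (λ k → p k * M (λ r w → fromℕ r * shifted k r w))
      -- Induction on the tail; the vanishing hypothesis persists because the first entry can only
      -- increase the weight.
      ≡⟨ ∑<-cong (suc b) (λ k → trans
           (cong (p k *_) (moment-size b m (h ∘ suc) a′ (shifted k) (λ r w b<w → vanish _ _ (ℕ.≤-trans b<w (ℕ.m≤n+m w _)))))
           (sym (∑<-*ˡ (p k) m (λ i → a (suc i) * M (shift 1 (g′ i) (shifted k)))))) ⟩
    ∑< (suc b) (λ k → ∑< m (λ i → p k * (a (suc i) * M (shift 1 (g′ i) (shifted k)))))
      ≡⟨ ∑<-swap (suc b) m (λ k i → p k * (a (suc i) * M (shift 1 (g′ i) (shifted k)))) ⟩
    ∑< m (λ i → ∑< (suc b) (λ k → p k * (a (suc i) * M (shift 1 (g′ i) (shifted k)))))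
      ≡⟨ ∑<-cong m (λ i → trans
           (∑<-cong (suc b) (λ k → trans (*-swap (p k) (a (suc i)) _) (cong (λ q → a (suc i) * (p k * q)) (commute i k))))
           (∑<-*ˡ (a (suc i)) (suc b) (λ k → p k * M (shift k (suc (h 0) ℕ.* k) (shift 1 (g′ i) ψ))))) ⟩
    ∑< m (λ i → a (suc i) * moment b (suc m) (suc ∘ h) a (shift 1 (g′ i) ψ)) ∎
    where
    commute : ∀ i k → M (shift 1 (g′ i) (shifted k)) ≡ M (shift k (suc (h 0) ℕ.* k) (shift 1 (g′ i) ψ))
    commute i k = moment-cong b m g′ a′ (λ r w → cong₂ ψ (ℕ.+-suc k r) (arith (suc (h 0) ℕ.* k) (g′ i) w))
      where
      arith : ∀ x y z → x ℕ.+ (y ℕ.+ z) ≡ y ℕ.+ (x ℕ.+ z)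
      arith = ℕ-Tactic.solve-∀

-- Composition sums as coefficients of power series

⋆-congʳ-≤ : ∀ f {g h} n → (∀ k → k ≤ n → g k ≡ h k) → (f ⋆ g) n ≡ (f ⋆ h) n
⋆-congʳ-≤ f zero    e = cong (f 0 *_) (e 0 z≤n)
⋆-congʳ-≤ f (suc n) e = cong₂ _+_ (cong (f 0 *_) (e (suc n) ℕ.≤-refl))
  (⋆-congʳ-≤ (f ∘ suc) n (λ k k≤n → e k (ℕ.≤-trans k≤n (ℕ.n≤1+n n))))

-- The hypotheses make `u i` equal to x^i times `u 0`, and terms with i > n do not reach degree n.
∑<-⋆ : ∀ a (u : ℕ → Series) → (∀ i → u (suc i) 0 ≡ 0ℚ) → (∀ i n → u (suc i) (suc n) ≡ u i n) →
  ∀ {n N} → n < N → ∑< N (λ i → a i * u i n) ≡ (a ⋆ u 0) n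
∑<-⋆ a u u₀ u₊ {zero}  {suc N} _         = trans
  (cong (a 0 * u 0 0 +_) (∑<-zero N (λ i → trans (cong (a (suc i) *_) (u₀ i)) (ℚ.*-zeroʳ (a (suc i))))))
  (ℚ.+-identityʳ (a 0 * u 0 0))
∑<-⋆ a u u₀ u₊ {suc n} {suc N} (s≤s n<N) = cong (a 0 * u 0 (suc n) +_) (trans
  (∑<-cong N (λ i → cong (a (suc i) *_) (u₊ i n)))
  (∑<-⋆ (a ∘ suc) u u₀ u₊ n<N))

1^≡1 : ∀ n → 1ℚ ^ℚ n ≡ 1ℚ
1^≡1 zero    = refl
1^≡1 (suc n) = trans (ℚ.*-identityˡ (1ℚ ^ℚ n)) (1^≡1 n)

-- Here D = 1 + t x R and R = a D, so D = 1 / (1 - t x a) enumerates compositions in which each part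
-- i + 1 carries the factor t aᵢ. R has one factor t and one factor x less, whence the exponent |v|
-- - 1 and the weight n + 1 for coefficient n. The signed sums take t = -1, the unsigned ones t = 1.
module _ (t : ℚ) (a D R : Series) (D₀ : D 0 ≡ 1ℚ) (D₊ : ∀ n → D (suc n) ≡ t * R n) (R≗a⋆D : R ≗ a ⋆ D) where

  private
    -- Chosen so that multiplication by r restores r!, which is the shape that `moment-size` takes
    -- apart.
    lowered : ℕ → ℕ → ℕ → ℚ
    lowered n r w = t ^ℚ (r ∸ 1) * fromℕ ((r ∸ 1) !) * δ w (suc n)

    -- At r = 0 the factor r kills the right side, and the left side vanishes too since w = 0
    -- differs from n + 1.
    lower-size : ∀ n r w → (r ≡ 0 → w ≡ 0) →
      t ^ℚ (r ∸ 1) * fromℕ (r !) * δ w (suc n) ≡ fromℕ r * lowered n r w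
    lower-size n zero    w r≡0⇒w≡0 with refl ← r≡0⇒w≡0 refl = refl
    lower-size n (suc r) w _       = begin
      t ^ℚ r * fromℕ (suc r ℕ.* r !) * δ w (suc n)               ≡⟨ cong (λ q → t ^ℚ r * q * δ w (suc n)) (fromℕ-* (suc r) (r !)) ⟩
      t ^ℚ r * (fromℕ (suc r) * fromℕ (r !)) * δ w (suc n)       ≡⟨ rearrange (t ^ℚ r) (fromℕ (suc r)) (fromℕ (r !)) (δ w (suc n)) ⟩
      fromℕ (suc r) * (t ^ℚ r * fromℕ (r !) * δ w (suc n))       ∎
      where
      rearrange : ∀ p q r s → p * (q * r) * s ≡ q * (p * r * s)
      rearrange = solve-∀ ℚ-ring

    -- The truncated r - 1 could break the identity only at r = 0, where δ is again zero.
    pull-t : ∀ n r w → (r ≡ 0 → w ≡ 0) →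
      t ^ℚ r * fromℕ (r !) * δ w (suc n) ≡ t * (t ^ℚ (r ∸ 1) * fromℕ (r !) * δ w (suc n))
    pull-t n zero    w r≡0⇒w≡0 with refl ← r≡0⇒w≡0 refl = sym (ℚ.*-zeroʳ t)
    pull-t n (suc r) w _       = assoc t (t ^ℚ r) (fromℕ (suc r !)) (δ w (suc n))
      where
      assoc : ∀ p q r s → p * q * r * s ≡ p * (q * r * s)
      assoc = solve-∀ ℚ-ring

  -- N is both the number of entries and their bound. It is kept apart from n because the recursion
  -- for `U` relates different weights over the same box of tuples.
  module _ (N : ℕ) where

    private
      full : ℕ → ℕ → ℕ → ℚ
      full n r w = t ^ℚ r * fromℕ (r !) * δ w n

      reduced : ℕ → ℕ → ℕ → ℚ
      reduced n r w = t ^ℚ (r ∸ 1) * fromℕ (r !) * δ w (suc n)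

      U : Series
      U n = moment N N suc a (full n)

      sumOver : (ℕ → ℕ → ℚ) → ℚ
      sumOver φ = ∑ (boundedTuples N N) (λ v → φ (size v) (weightBy suc v) * dividedPowers a v)

      vanish : ∀ {n} → n < N → ∀ r w → N < w → lowered n r w ≡ 0ℚ
      vanish {n} n<N r w N<w = trans (cong (t ^ℚ (r ∸ 1) * fromℕ ((r ∸ 1) !) *_) (δ-≢ {w} {suc n} (λ { refl → ℕ.<⇒≱ N<w n<N })))
        (ℚ.*-zeroʳ (t ^ℚ (r ∸ 1) * fromℕ ((r ∸ 1) !)))

      -- Removing a part i + 1 leaves the coefficient aᵢ and a tuple of weight n - i, counted by
      -- `U`: `moment-size` yields the sum over i and `∑<-⋆` recognises it as a product.
      sumOver-reduced : ∀ {n} → n < N → sumOver (reduced n) ≡ (a ⋆ U) n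
      sumOver-reduced {n} n<N = begin
        sumOver (reduced n)
          ≡⟨ ∑-cong (boundedTuples N N) (λ v → cong (_* dividedPowers a v)
               (lower-size n (size v) (weightBy suc v) (size≡0⇒weightBy≡0 suc v))) ⟩
        sumOver (λ r w → fromℕ r * lowered n r w)                    ≡⟨ ∑-boundedTuples N N suc a (λ r w → fromℕ r * lowered n r w) ⟩
        moment N N suc a (λ r w → fromℕ r * lowered n r w)           ≡⟨ moment-size N N id a (lowered n) (vanish n<N) ⟩
        ∑< N (λ i → a i * u i n)                                     ≡⟨ ∑<-⋆ a u u₀ (λ _ _ → refl) n<N ⟩
        (a ⋆ U) n                                                    ∎
        where
        u : ℕ → Series
        u i n = moment N N suc a (λ r w → t ^ℚ r * fromℕ (r !) * δ (i ℕ.+ w) n)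

        u₀ : ∀ i → u (suc i) 0 ≡ 0ℚ
        u₀ i = moment-zero N N suc a (λ r w → ℚ.*-zeroʳ (t ^ℚ r * fromℕ (r !)))

      U-suc : ∀ {n} → n < N → U (suc n) ≡ t * (a ⋆ U) n
      U-suc {n} n<N = begin
        moment N N suc a (full (suc n))     ≡⟨ ∑-boundedTuples N N suc a (full (suc n)) ⟨
        sumOver (full (suc n))
          ≡⟨ ∑-cong (boundedTuples N N) (λ v → trans
               (cong (_* dividedPowers a v) (pull-t n (size v) (weightBy suc v) (size≡0⇒weightBy≡0 suc v)))
               (ℚ.*-assoc t (reduced n (size v) (weightBy suc v)) (dividedPowers a v))) ⟩
        ∑ (boundedTuples N N) (λ v → t * (reduced n (size v) (weightBy suc v) * dividedPowers a v))
          ≡⟨ ∑-*ˡ t (boundedTuples N N) (λ v → reduced n (size v) (weightBy suc v) * dividedPowers a v) ⟩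
        t * sumOver (reduced n)             ≡⟨ cong (t *_) (sumOver-reduced n<N) ⟩
        t * (a ⋆ U) n                       ∎

      -- Both series obey the same recursion. The induction carries all k ≤ n, since coefficient n
      -- of `a ⋆ U` depends on all of them.
      U≡D : ∀ n → n ≤ N → ∀ k → k ≤ n → U k ≡ D k
      U≡D zero    _   zero _ = trans
        (moment-origin N N id a (full 0) (λ r w → ℚ.*-zeroʳ (t ^ℚ r * fromℕ (r !))))
        (sym D₀)
      U≡D (suc n) n<N k    k≤1+n with ℕ.m≤n⇒m<n∨m≡n k≤1+n
      ... | inj₁ (s≤s k≤n) = U≡D n (ℕ.<⇒≤ n<N) k k≤n
      ... | inj₂ refl      = begin
        U (suc n)        ≡⟨ U-suc n<N ⟩
        t * (a ⋆ U) n    ≡⟨ cong (t *_) (⋆-congʳ-≤ a n (U≡D n (ℕ.<⇒≤ n<N))) ⟩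
        t * (a ⋆ D) n    ≡⟨ cong (t *_) (R≗a⋆D n) ⟨
        t * R n          ≡⟨ D₊ n ⟨
        D (suc n)        ∎

    ∑-reduced : ∀ {n} → n < N → sumOver (reduced n) ≡ R n
    ∑-reduced {n} n<N = begin
      sumOver (reduced n)  ≡⟨ sumOver-reduced n<N ⟩
      (a ⋆ U) n            ≡⟨ ⋆-congʳ-≤ a n (U≡D n (ℕ.<⇒≤ n<N)) ⟩
      (a ⋆ D) n            ≡⟨ R≗a⋆D n ⟨
      R n                  ∎

  -- The choice N = n + 1 gives exactly the box that `tuples` filters; the filter turns into the
  -- factor δ.
  compositionSum : ∀ n → (∑[weight≡ suc n ] λ v →
    t ^ℚ (size v ∸ 1) * multinomial v * ∏ (λ i → a (toℕ i) ^ℚ lookup v i)) ≡ R n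
  compositionSum n = begin
    ∑[weight≡ suc n ] f
      ≡⟨ ∑-filter (λ v → weight v ℕ.≟ suc n) (λ v → δ (weight v) (suc n)) (λ { _ e → trans (cong (λ w → δ w (suc n)) e) (δ-refl (suc n)) }) (λ _ → δ-≢) (boundedTuples (suc n) (suc n)) f ⟩
    ∑ (boundedTuples (suc n) (suc n)) (λ v → δ (weight v) (suc n) * f v)
      ≡⟨ ∑-cong (boundedTuples (suc n) (suc n)) (λ v → begin
           δ (weight v) (suc n) * (t ^ℚ (size v ∸ 1) * multinomial v * powers v)
             ≡⟨ cong (δ (weight v) (suc n) *_) (ℚ.*-assoc (t ^ℚ (size v ∸ 1)) (multinomial v) (powers v)) ⟩
           δ (weight v) (suc n) * (t ^ℚ (size v ∸ 1) * (multinomial v * powers v))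
             ≡⟨ cong (λ q → δ (weight v) (suc n) * (t ^ℚ (size v ∸ 1) * q)) (multinomial*powers a v) ⟩
           δ (weight v) (suc n) * (t ^ℚ (size v ∸ 1) * (fromℕ (size v !) * dividedPowers a v))
             ≡⟨ rearrange (δ (weight v) (suc n)) (t ^ℚ (size v ∸ 1)) (fromℕ (size v !)) (dividedPowers a v) ⟩
           t ^ℚ (size v ∸ 1) * fromℕ (size v !) * δ (weight v) (suc n) * dividedPowers a v ∎) ⟩
    ∑ (boundedTuples (suc n) (suc n)) (λ v → t ^ℚ (size v ∸ 1) * fromℕ (size v !) * δ (weight v) (suc n) * dividedPowers a v)
      ≡⟨ ∑-reduced (suc n) ℕ.≤-refl ⟩
    R n ∎
    where
    powers : Vec ℕ (suc n) → ℚ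
    powers v = ∏ (λ i → a (toℕ i) ^ℚ lookup v i)

    f : Vec ℕ (suc n) → ℚ
    f v = t ^ℚ (size v ∸ 1) * multinomial v * powers v

    rearrange : ∀ p q r s → p * (q * (r * s)) ≡ q * r * p * s
    rearrange = solve-∀ ℚ-ring

signedSum : ∀ k a R → R ≗ (λ i → a (k ℕ.+ i)) ⋆ (const 1ℚ ⊖ X ⋆ R) →
  ∀ n → (∑[weight≡ suc n ] λ v → sign v * multinomial v * powersFrom k a v) ≡ R n
signedSum k a R = compositionSum (- 1ℚ) (λ i → a (k ℕ.+ i)) (const 1ℚ ⊖ X ⋆ R) R
  (cong (λ q → 1ℚ + - q) (X⋆-zero R))
  (λ n → trans (cong (λ q → 0ℚ + - q) (X⋆-suc R n)) (0-x (R n)))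
  where
  0-x : ∀ x → 0ℚ + - x ≡ - 1ℚ * x
  0-x = solve-∀ ℚ-ring

unsignedSum : ∀ k a R → R ≗ (λ i → a (k ℕ.+ i)) ⋆ (const 1ℚ ⊕ X ⋆ R) →
  ∀ n → (∑[weight≡ suc n ] λ v → multinomial v * powersFrom k a v) ≡ R n
unsignedSum k a R e n = trans
  (∑-cong (tuples (suc n) (suc n)) (λ v → cong (_* powersFrom k a v)
    (sym (trans (cong (_* multinomial v) (1^≡1 (size v ∸ 1))) (ℚ.*-identityˡ (multinomial v))))))
  (compositionSum 1ℚ (λ i → a (k ℕ.+ i)) (const 1ℚ ⊕ X ⋆ R) R
    (cong (1ℚ +_) (X⋆-zero R))
    (λ n → trans (cong (0ℚ +_) (X⋆-suc R n)) (0+x (R n)))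
    e n)
  where
  0+x : ∀ x → 0ℚ + x ≡ 1ℚ * x
  0+x = solve-∀ ℚ-ring

-- The closed formula for S

fromℕ-sum : ∀ {A : Set} (f : A → ℕ) xs → fromℕ (sum (List.map f xs)) ≡ ∑ xs (fromℕ ∘ f)
fromℕ-sum f []       = refl
fromℕ-sum f (x ∷ xs) = trans (fromℕ-+ (f x) (sum (List.map f xs))) (cong (fromℕ (f x) +_) (fromℕ-sum f xs))

-- Induction with Pascal's rule. The identity is what links `M (suc n) n` to `M n (suc n)` in `S≡Δ`.
C-absorb : ∀ n k → suc k ℕ.* (suc n C suc k) ≡ suc n ℕ.* (n C k)
C-absorb zero    zero    = refl
C-absorb zero    (suc k) = trans (cong (2+ k ℕ.*_) (k>n⇒nCk≡0 {1} {2+ k} (s≤s (s≤s z≤n)))) (ℕ.*-zeroʳ (2+ k))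
C-absorb (suc n) zero    = trans (ℕ.*-identityˡ (2+ n C 1)) (trans (nC1≡n (2+ n)) (sym (ℕ.*-identityʳ (2+ n))))
C-absorb (suc n) (suc k) = begin
  2+ k ℕ.* (2+ n C 2+ k)                                              ≡⟨ cong (2+ k ℕ.*_) (nCk+nC[k+1]≡[n+1]C[k+1] (suc n) (suc k)) ⟨
  2+ k ℕ.* ((suc n C suc k) ℕ.+ (suc n C 2+ k))                       ≡⟨ expand k (suc n C suc k) (suc n C 2+ k) ⟩
  (suc n C suc k) ℕ.+ (suc k ℕ.* (suc n C suc k) ℕ.+ 2+ k ℕ.* (suc n C 2+ k))
    ≡⟨ cong ((suc n C suc k) ℕ.+_) (cong₂ ℕ._+_ (C-absorb n k) (C-absorb n (suc k))) ⟩
  (suc n C suc k) ℕ.+ (suc n ℕ.* (n C k) ℕ.+ suc n ℕ.* (n C suc k))   ≡⟨ cong ((suc n C suc k) ℕ.+_) (ℕ.*-distribˡ-+ (suc n) (n C k) (n C suc k)) ⟨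
  (suc n C suc k) ℕ.+ suc n ℕ.* ((n C k) ℕ.+ (n C suc k))             ≡⟨ cong (λ c → (suc n C suc k) ℕ.+ suc n ℕ.* c) (nCk+nC[k+1]≡[n+1]C[k+1] n k) ⟩
  2+ n ℕ.* (suc n C suc k)                                            ∎
  where
  expand : ∀ k x y → 2+ k ℕ.* (x ℕ.+ y) ≡ x ℕ.+ (suc k ℕ.* x ℕ.+ 2+ k ℕ.* y)
  expand = ℕ-Tactic.solve-∀

-- The coefficient of x^b in ((1 + x) / (1 - x))^a.
M : ℕ → ℕ → ℚ
M zero    zero    = 1ℚ
M zero    (suc b) = 0ℚ
M (suc a) zero    = 1ℚ
M (suc a) (suc b) = M (suc a) b + M a (suc b) + M a b

M-zero : ∀ a → M a 0 ≡ 1ℚ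
M-zero zero    = refl
M-zero (suc a) = refl

-- `term a b` is the summand for x^(b+1) in the expansion of (1 + 2x / (1 - x))^a.
-- `diagonalTerm a b` is its increment in a, and twice the summand of the Delannoy number of (a, b).
term diagonalTerm : ℕ → ℕ → ℕ → ℚ
term         a b k = fromℕ (2 ℕ.^ suc k ℕ.* (a C suc k) ℕ.* (b C k))
diagonalTerm a b k = fromℕ (2 ℕ.^ suc k ℕ.* (a C k) ℕ.* (b C k))

term-zero : ∀ a {b k} → b < k → term a b k ≡ 0ℚ
term-zero a {b} {k} b<k = cong fromℕ (trans (cong (2 ℕ.^ suc k ℕ.* (a C suc k) ℕ.*_) (k>n⇒nCk≡0 b<k)) (ℕ.*-zeroʳ (2 ℕ.^ suc k ℕ.* (a C suc k))))

term-suc : ∀ a b k → term (suc a) b k ≡ term a b k + diagonalTerm a b k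
term-suc a b k = trans (cong fromℕ (trans
    (cong (λ c → 2 ℕ.^ suc k ℕ.* c ℕ.* (b C k)) (sym (nCk+nC[k+1]≡[n+1]C[k+1] a k)))
    (expand (2 ℕ.^ suc k) (a C k) (a C suc k) (b C k))))
  (fromℕ-+ (2 ℕ.^ suc k ℕ.* (a C suc k) ℕ.* (b C k)) (2 ℕ.^ suc k ℕ.* (a C k) ℕ.* (b C k)))
  where
  expand : ∀ p x y z → p ℕ.* (x ℕ.+ y) ℕ.* z ≡ p ℕ.* y ℕ.* z ℕ.+ p ℕ.* x ℕ.* z
  expand = ℕ-Tactic.solve-∀

∑<-term-suc : ∀ K a b → ∑< K (term (suc a) b) ≡ ∑< K (term a b) + ∑< K (diagonalTerm a b)
∑<-term-suc K a b = trans (∑<-cong K (term-suc a b)) (∑<-+ K (term a b) (diagonalTerm a b))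

diagonalTerm-suc : ∀ a b k → diagonalTerm a (suc b) (suc k) ≡ diagonalTerm a b (suc k) + (term a b k + term a b k)
diagonalTerm-suc a b k = begin
  fromℕ (2 ℕ.^ 2+ k ℕ.* (a C suc k) ℕ.* (suc b C suc k))
    ≡⟨ cong fromℕ (trans (cong (2 ℕ.^ 2+ k ℕ.* (a C suc k) ℕ.*_) (sym (nCk+nC[k+1]≡[n+1]C[k+1] b k)))
         (expand (2 ℕ.^ suc k) (a C suc k) (b C k) (b C suc k))) ⟩
  fromℕ (d ℕ.+ (t ℕ.+ t))     ≡⟨ fromℕ-+ d (t ℕ.+ t) ⟩
  fromℕ d + fromℕ (t ℕ.+ t)   ≡⟨ cong (fromℕ d +_) (fromℕ-+ t t) ⟩
  fromℕ d + (fromℕ t + fromℕ t) ∎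
  where
  d = 2 ℕ.^ 2+ k ℕ.* (a C suc k) ℕ.* (b C suc k)
  t = 2 ℕ.^ suc k ℕ.* (a C suc k) ℕ.* (b C k)

  expand : ∀ p x y z → 2 ℕ.* p ℕ.* x ℕ.* (y ℕ.+ z) ≡ 2 ℕ.* p ℕ.* x ℕ.* z ℕ.+ (p ℕ.* x ℕ.* y ℕ.+ p ℕ.* x ℕ.* y)
  expand = ℕ-Tactic.solve-∀

-- Pascal's rule in b. One of the two pieces has its index shifted by one; the top term it lacks
-- vanishes because b < K.
∑<-diagonalTerm-suc : ∀ {K} a b → b < K →
  ∑< (suc K) (diagonalTerm a (suc b)) ≡ ∑< (suc K) (diagonalTerm a b) + (∑< (suc K) (term a b) + ∑< (suc K) (term a b))
∑<-diagonalTerm-suc {K} a b b<K = begin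
  diagonalTerm a b 0 + ∑< K (λ k → diagonalTerm a (suc b) (suc k))
    ≡⟨ cong (diagonalTerm a b 0 +_) (trans (∑<-cong K (diagonalTerm-suc a b)) (∑<-+ K (diagonalTerm a b ∘ suc) (λ k → term a b k + term a b k))) ⟩
  diagonalTerm a b 0 + (∑< K (diagonalTerm a b ∘ suc) + ∑< K (λ k → term a b k + term a b k))
    ≡⟨ ℚ.+-assoc (diagonalTerm a b 0) (∑< K (diagonalTerm a b ∘ suc)) (∑< K (λ k → term a b k + term a b k)) ⟨
  ∑< (suc K) (diagonalTerm a b) + ∑< K (λ k → term a b k + term a b k)
    ≡⟨ cong (∑< (suc K) (diagonalTerm a b) +_) (trans (∑<-+ K (term a b) (term a b)) (cong₂ _+_ (sym extend) (sym extend))) ⟩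
  ∑< (suc K) (diagonalTerm a b) + (∑< (suc K) (term a b) + ∑< (suc K) (term a b)) ∎
  where
  extend : ∑< (suc K) (term a b) ≡ ∑< K (term a b)
  extend = trans (∑<-last K (term a b)) (trans (cong (∑< K (term a b) +_) (term-zero a b<K)) (ℚ.+-identityʳ (∑< K (term a b))))

-- The recursion of `M` is a combination of the rules for increasing a and b. Any range K beyond b
-- is allowed, so that the values at b and b + 1 share a range.
M-closed : ∀ a {b K} → b < K → M a (suc b) ≡ ∑< K (term a b)
M-closed zero {b} {K} _ = sym (∑<-zero K (λ k → cong fromℕ
  (trans (cong (λ c → 2 ℕ.^ suc k ℕ.* c ℕ.* (b C k)) (k>n⇒nCk≡0 {0} {suc k} (s≤s z≤n)))
    (cong (ℕ._* (b C k)) (ℕ.*-zeroʳ (2 ℕ.^ suc k))))))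
M-closed (suc a) {zero} {suc K} b<K = begin
  1ℚ + M a 1 + M a 0                                            ≡⟨ cong₂ (λ x y → 1ℚ + x + y) (M-closed a b<K) (M-zero a) ⟩
  1ℚ + ∑< (suc K) (term a 0) + 1ℚ                               ≡⟨ rearrange (∑< (suc K) (term a 0)) ⟩
  -- The 2 is `diagonalTerm a 0 0`, the only nonzero one for b = 0.
  ∑< (suc K) (term a 0) + (fromℕ 2 + 0ℚ)
    ≡⟨ cong (λ q → ∑< (suc K) (term a 0) + (fromℕ 2 + q)) (∑<-zero K (λ k → cong fromℕ
         (trans (cong (2 ℕ.^ 2+ k ℕ.* (a C suc k) ℕ.*_) (k>n⇒nCk≡0 {0} {suc k} (s≤s z≤n))) (ℕ.*-zeroʳ (2 ℕ.^ 2+ k ℕ.* (a C suc k)))))) ⟨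
  ∑< (suc K) (term a 0) + ∑< (suc K) (diagonalTerm a 0)         ≡⟨ ∑<-term-suc (suc K) a 0 ⟨
  ∑< (suc K) (term (suc a) 0)                                   ∎
  where
  rearrange : ∀ x → 1ℚ + x + 1ℚ ≡ x + (fromℕ 2 + 0ℚ)
  rearrange = solve-∀ ℚ-ring
M-closed (suc a) {suc b} {suc K} (s≤s b<K) = begin
  M (suc a) (suc b) + M a (2+ b) + M a (suc b)
    ≡⟨ cong₂ _+_ (cong₂ _+_ (trans (M-closed (suc a) b<1+K) (∑<-term-suc (suc K) a b)) (M-closed a (s≤s b<K))) (M-closed a b<1+K) ⟩
  T + ∑< (suc K) (diagonalTerm a b) + ∑< (suc K) (term a (suc b)) + T    ≡⟨ rearrange T (∑< (suc K) (diagonalTerm a b)) (∑< (suc K) (term a (suc b))) ⟩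
  ∑< (suc K) (term a (suc b)) + (∑< (suc K) (diagonalTerm a b) + (T + T))
    ≡⟨ cong (∑< (suc K) (term a (suc b)) +_) (∑<-diagonalTerm-suc a b b<K) ⟨
  ∑< (suc K) (term a (suc b)) + ∑< (suc K) (diagonalTerm a (suc b))    ≡⟨ ∑<-term-suc (suc K) a (suc b) ⟨
  ∑< (suc K) (term (suc a) (suc b)) ∎
  where
  T = ∑< (suc K) (term a b)

  b<1+K : b < suc K
  b<1+K = ℕ.m≤n⇒m≤1+n b<K

  rearrange : ∀ t d u → t + d + u + t ≡ u + (d + (t + t))
  rearrange = solve-∀ ℚ-ring

Δ : ℕ → ℕ → ℚ
Δ m n = M m n + - M n m

-- The recursion of `M` at two positive arguments is symmetric in them, so it passes to the
-- antisymmetrisation.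
Δ-suc-suc : ∀ m n → Δ (suc m) (suc n) ≡ Δ m (suc n) + (Δ m n + Δ (suc m) n)
Δ-suc-suc m n = rearrange (M (suc m) n) (M m (suc n)) (M m n) (M (suc n) m) (M n (suc m)) (M n m)
  where
  rearrange : ∀ a b c d e f → a + b + c + - (d + e + f) ≡ b + - d + (c + - f + (a + - e))
  rearrange = solve-∀ ℚ-ring

-- Put T = `M n (suc n)`, which is n S_n by the closed form. Absorption gives n `M (suc n) n` = (n +
-- 1) T, hence n (`M (suc n) n` - T) = T.
S≡Δ : ∀ n → S n ≡ Δ (suc n) n
S≡Δ zero      = refl
S≡Δ n@(suc p) = begin
  S n                                                                ≡⟨ /≡*recip (sum (List.map f (applyUpTo suc n))) n ⟩
  fromℕ (sum (List.map f (applyUpTo suc n))) * recip n               ≡⟨ cong (_* recip n) (trans (fromℕ-sum f (applyUpTo suc n)) (∑-applyUpTo suc n (fromℕ ∘ f))) ⟩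
  T * recip n                                                        ≡⟨ cong (_* recip n) (difference (fromℕ n) T (M (suc n) n) [1+n]*T) ⟩
  fromℕ n * (M (suc n) n + - T) * recip n                            ≡⟨ cong (λ q → fromℕ n * (M (suc n) n + - q) * recip n) M[n,1+n]≡T ⟨
  fromℕ n * Δ (suc n) n * recip n                                    ≡⟨ swap (fromℕ n) (Δ (suc n) n) (recip n) ⟩
  fromℕ n * recip n * Δ (suc n) n                                    ≡⟨ cong (_* Δ (suc n) n) (fromℕ*recip n) ⟩
  1ℚ * Δ (suc n) n                                                   ≡⟨ ℚ.*-identityˡ (Δ (suc n) n) ⟩
  Δ (suc n) n                                                        ∎
  where
  f : ℕ → ℕ
  f k = 2 ℕ.^ k ℕ.* (n C k) ℕ.* (n C (k ∸ 1))

  T : ℚ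
  T = ∑< n (term n n)

  M[n,1+n]≡T : M n (suc n) ≡ T
  M[n,1+n]≡T = begin
    M n (suc n)                ≡⟨ M-closed n (ℕ.n<1+n n) ⟩
    ∑< (suc n) (term n n)      ≡⟨ ∑<-last n (term n n) ⟩
    T + term n n n             ≡⟨ cong (T +_) (cong fromℕ (cong (ℕ._* (n C n)) (trans (cong (2 ℕ.^ suc n ℕ.*_) (k>n⇒nCk≡0 (ℕ.n<1+n n))) (ℕ.*-zeroʳ (2 ℕ.^ suc n))))) ⟩
    T + 0ℚ                     ≡⟨ ℚ.+-identityʳ T ⟩
    T                          ∎

  -- Absorption turns n C(n - 1, k) into (k + 1) C(n, k + 1), and the freed k + 1 turns C(n + 1, k +
  -- 1) into (n + 1) C(n, k).
  absorb : ∀ k → fromℕ n * term (suc n) p k ≡ fromℕ (suc n) * term n n k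
  absorb k = trans (sym (fromℕ-* n (P ℕ.* (suc n C suc k) ℕ.* (p C k)))) (trans (cong fromℕ (begin
    n ℕ.* (P ℕ.* (suc n C suc k) ℕ.* (p C k))          ≡⟨ rearrange₁ n P (suc n C suc k) (p C k) ⟩
    P ℕ.* (suc n C suc k) ℕ.* (n ℕ.* (p C k))          ≡⟨ cong (P ℕ.* (suc n C suc k) ℕ.*_) (C-absorb p k) ⟨
    P ℕ.* (suc n C suc k) ℕ.* (suc k ℕ.* (n C suc k))  ≡⟨ rearrange₂ P (suc n C suc k) (suc k) (n C suc k) ⟩
    P ℕ.* (n C suc k) ℕ.* (suc k ℕ.* (suc n C suc k))  ≡⟨ cong (P ℕ.* (n C suc k) ℕ.*_) (C-absorb n k) ⟩
    P ℕ.* (n C suc k) ℕ.* (suc n ℕ.* (n C k))          ≡⟨ rearrange₁ (suc n) P (n C suc k) (n C k) ⟨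
    suc n ℕ.* (P ℕ.* (n C suc k) ℕ.* (n C k))          ∎)) (fromℕ-* (suc n) (P ℕ.* (n C suc k) ℕ.* (n C k))))
    where
    P = 2 ℕ.^ suc k

    rearrange₁ : ∀ n p x y → n ℕ.* (p ℕ.* x ℕ.* y) ≡ p ℕ.* x ℕ.* (n ℕ.* y)
    rearrange₁ = ℕ-Tactic.solve-∀

    rearrange₂ : ∀ p x k y → p ℕ.* x ℕ.* (k ℕ.* y) ≡ p ℕ.* y ℕ.* (k ℕ.* x)
    rearrange₂ = ℕ-Tactic.solve-∀

  [1+n]*T : fromℕ n * M (suc n) n ≡ T + fromℕ n * T
  [1+n]*T = begin
    fromℕ n * M (suc n) n                  ≡⟨ cong (fromℕ n *_) (M-closed (suc n) {p} ℕ.≤-refl) ⟩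
    fromℕ n * ∑< n (term (suc n) p)        ≡⟨ ∑<-*ˡ (fromℕ n) n (term (suc n) p) ⟨
    ∑< n (λ k → fromℕ n * term (suc n) p k) ≡⟨ ∑<-cong n absorb ⟩
    ∑< n (λ k → fromℕ (suc n) * term n n k) ≡⟨ ∑<-*ˡ (fromℕ (suc n)) n (term n n) ⟩
    fromℕ (suc n) * T                      ≡⟨ cong (_* T) (fromℕ-+ 1 n) ⟩
    (1ℚ + fromℕ n) * T                     ≡⟨ expand (fromℕ n) T ⟩
    T + fromℕ n * T                        ∎
    where
    expand : ∀ x y → (1ℚ + x) * y ≡ y + x * y
    expand = solve-∀ ℚ-ring

  difference : ∀ x t y → x * y ≡ t + x * t → t ≡ x * (y + - t)
  difference x t y e = begin
    t                          ≡⟨ lhs x t ⟩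
    t + x * t + - (x * t)      ≡⟨ cong (_+ - (x * t)) e ⟨
    x * y + - (x * t)          ≡⟨ rhs x y t ⟩
    x * (y + - t)              ∎
    where
    lhs : ∀ x t → t ≡ t + x * t + - (x * t)
    lhs = solve-∀ ℚ-ring

    rhs : ∀ x y t → x * y + - (x * t) ≡ x * (y + - t)
    rhs = solve-∀ ℚ-ring

  swap : ∀ x y z → x * y * z ≡ x * z * y
  swap = solve-∀ ℚ-ring

-- Families of path series

-- For paths from height j + 1, x counts half the excess of the length over j + 1: a down step keeps
-- the excess, a level or an up step uses one x.
Descending : (ℕ → Series) → Set
Descending w = ∀ j → w (suc j) ≗ w j ⊕ X ⋆ (w (suc j) ⊕ w (2+ j))

descending : ∀ w → (∀ j → w (suc j) 0 ≡ w j 0) →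
  (∀ j n → w (suc j) (suc n) ≡ w j (suc n) + (w (suc j) n + w (2+ j) n)) → Descending w
descending w w₀ w₊ j zero    = trans (w₀ j) (sym (trans
  (cong (w j 0 +_) (X⋆-zero (w (suc j) ⊕ w (2+ j)))) (ℚ.+-identityʳ (w j 0))))
descending w w₀ w₊ j (suc n) = trans (w₊ j n) (cong (w j (suc n) +_) (sym (X⋆-suc (w (suc j) ⊕ w (2+ j)) n)))

-- The explicit candidate for S^j. The case j = 0 stands apart because `Δ n n` is zero even at n =
-- 0, where S^0 has coefficient 1.
S-power : ℕ → Series
S-power zero    n = const 1ℚ n
S-power (suc j) n = Δ (suc (n ℕ.+ j)) n

S-power-descending : Descending S-power
S-power-descending = descending S-power initial S-power₊
  where
  initial : ∀ j → S-power (suc j) 0 ≡ S-power j 0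
  initial zero    = refl
  initial (suc j) = refl

  diagonal : ∀ j n → Δ (suc (n ℕ.+ j)) (suc n) ≡ S-power j (suc n)
  diagonal zero    n = trans (cong (λ m → Δ (suc m) (suc n)) (ℕ.+-identityʳ n)) (ℚ.+-inverseʳ (M (suc n) (suc n)))
  diagonal (suc j) n = cong (λ m → Δ (suc m) (suc n)) (ℕ.+-suc n j)

  S-power₊ : ∀ j n → S-power (suc j) (suc n) ≡ S-power j (suc n) + (S-power (suc j) n + S-power (2+ j) n)
  S-power₊ j n = trans (Δ-suc-suc (suc (n ℕ.+ j)) n)
    (cong₂ (λ x m → x + (S-power (suc j) n + Δ (suc m) n)) (diagonal j n) (sym (ℕ.+-suc n j)))

-- For fixed j both sides solve the same recursion in i with the same start. Degree n at i + 1 needs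
-- degree n at i and degree n - 1 at i + 1 and i + 2, so the induction is lexicographic in (n, i).
S-power-⋆ : ∀ w → Descending w → ∀ i j → S-power i ⋆ w j ≗ w (i ℕ.+ j)
S-power-⋆ w w-desc = λ i j n → go n i j
  where
  step : ∀ i j n → (S-power (suc i) ⋆ w j) n ≡ (S-power i ⋆ w j) n + (X ⋆ (S-power (suc i) ⋆ w j ⊕ S-power (2+ i) ⋆ w j)) n
  step i j n = begin
    (S-power (suc i) ⋆ w j) n
      ≡⟨ ⋆-cong {g = w j} (S-power-descending i) (λ _ → refl) n ⟩
    ((S-power i ⊕ X ⋆ (S-power (suc i) ⊕ S-power (2+ i))) ⋆ w j) n
      ≡⟨ series-solve 5 (λ x a b c d → (a :+ x :* (b :+ c)) :* d := a :* d :+ x :* (b :* d :+ c :* d)) (λ _ → refl) X (S-power i) (S-power (suc i)) (S-power (2+ i)) (w j) n ⟩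
    (S-power i ⋆ w j) n + (X ⋆ (S-power (suc i) ⋆ w j ⊕ S-power (2+ i) ⋆ w j)) n ∎

  go : ∀ n i j → (S-power i ⋆ w j) n ≡ w (i ℕ.+ j) n
  go n       zero    j = trans (const-⋆ 1ℚ (w j) n) (ℚ.*-identityˡ (w j n))
  go zero    (suc i) j = begin
    (S-power (suc i) ⋆ w j) 0   ≡⟨ step i j 0 ⟩
    (S-power i ⋆ w j) 0 + (X ⋆ (S-power (suc i) ⋆ w j ⊕ S-power (2+ i) ⋆ w j)) 0
      ≡⟨ cong₂ _+_ (go 0 i j) (trans (X⋆-zero (S-power (suc i) ⋆ w j ⊕ S-power (2+ i) ⋆ w j)) (sym (X⋆-zero (w (suc i ℕ.+ j) ⊕ w (2+ i ℕ.+ j))))) ⟩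
    w (i ℕ.+ j) 0 + (X ⋆ (w (suc i ℕ.+ j) ⊕ w (2+ i ℕ.+ j))) 0   ≡⟨ w-desc (i ℕ.+ j) 0 ⟨
    w (suc i ℕ.+ j) 0 ∎
  go (suc n) (suc i) j = begin
    (S-power (suc i) ⋆ w j) (suc n)   ≡⟨ step i j (suc n) ⟩
    (S-power i ⋆ w j) (suc n) + (X ⋆ (S-power (suc i) ⋆ w j ⊕ S-power (2+ i) ⋆ w j)) (suc n)
      ≡⟨ cong₂ _+_ (go (suc n) i j) (trans (X⋆-suc (S-power (suc i) ⋆ w j ⊕ S-power (2+ i) ⋆ w j) n)
           (trans (cong₂ _+_ (go n (suc i) j) (go n (2+ i) j)) (sym (X⋆-suc (w (suc i ℕ.+ j) ⊕ w (2+ i ℕ.+ j)) n)))) ⟩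
    w (i ℕ.+ j) (suc n) + (X ⋆ (w (suc i ℕ.+ j) ⊕ w (2+ i ℕ.+ j))) (suc n)   ≡⟨ w-desc (i ℕ.+ j) (suc n) ⟨
    w (suc i ℕ.+ j) (suc n) ∎

S≗S-power : S ≗ S-power 1
S≗S-power n = trans (S≡Δ n) (cong (λ m → Δ (suc m) n) (sym (ℕ.+-identityʳ n)))

S-⋆ : ∀ w → Descending w → w 1 ≗ S ⋆ w 0
S-⋆ w w-desc n = sym (trans (⋆-cong {g = w 0} S≗S-power (λ _ → refl) n) (S-power-⋆ w w-desc 1 0 n))

-- The recursion of `S-power` at j = 0; `S-power 2` is S² because `S-power-⋆` applies to the
-- descending family `S-power` itself.
S-equation : S ≗ const 1ℚ ⊕ X ⋆ (S ⊕ S ⋆ S)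
S-equation n = begin
  S n                              ≡⟨ S≗S-power n ⟩
  S-power 1 n                      ≡⟨ S-power-descending 0 n ⟩
  (const 1ℚ ⊕ X ⋆ (S-power 1 ⊕ S-power 2)) n
    ≡⟨ cong (const 1ℚ n +_) (⋆-cong {X} (λ _ → refl) (λ k → cong₂ _+_ (sym (S≗S-power k)) (sym (trans (⋆-cong S≗S-power S≗S-power k) (S-power-⋆ S-power S-power-descending 1 1 k)))) n) ⟩
  (const 1ℚ ⊕ X ⋆ (S ⊕ S ⋆ S)) n   ∎

-- The summand 1 matters only in degree 0, where ½ (1 + 1) = 1 accounts for the exceptional s₀.
s-equation : s ≗ const ½ ⋆ (const 1ℚ ⊕ S)
s-equation zero    = refl
s-equation (suc n) = sym (trans (const-⋆ ½ (const 1ℚ ⊕ S) (suc n)) (cong (½ *_) (ℚ.+-identityˡ (S (suc n)))))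

-- Schröder paths split by their first step

paths-short : ∀ y l → l < y → paths y l ≡ []
paths-short (suc y) zero    _         = refl
paths-short (suc y) (suc l) (s≤s l<y) = cong₂ _++_
  (cong (List.map u∷_) (paths-short (2+ y) l (ℕ.m≤n⇒m≤1+n (ℕ.m≤n⇒m≤1+n l<y))))
  (cong₂ _++_ (cong (List.map d∷_) (paths-short y l l<y)) (level-short l l<y))
  where
  level-short : ∀ l → l < y → pathsH (suc y) l ≡ []
  level-short zero    _     = refl
  level-short (suc l) 1+l<y = cong (List.map h∷_) (paths-short (suc y) l (ℕ.m≤n⇒m≤1+n (ℕ.<⇒≤ 1+l<y)))

-- Unlike `2 ℕ.* n`, this exposes two successors at once, so that `paths` unfolds by computation.
double : ℕ → ℕ
double zero    = 0
double (suc n) = 2+ (double n)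

2*n≡double : ∀ n → 2 ℕ.* n ≡ double n ℕ.+ 0
2*n≡double zero    = refl
2*n≡double (suc n) = cong suc (trans (ℕ.+-suc n (n ℕ.+ 0)) (cong suc (2*n≡double n)))

module _ (g : ℕ → ℕ → ℚ) where

  statistic : ∀ {y l} → Path y l → ℚ
  statistic p = g (low p) (hills p)

  ∑paths : ℕ → ℕ → ℚ
  ∑paths y l = ∑ (paths y l) statistic

  ∑paths-level : ℕ → ℕ → ℚ
  ∑paths-level y l = ∑ (pathsH y l) statistic

  -- The paths from height j end at length 2n + j for some n.
  excursions : ℕ → Series
  excursions j n = ∑paths j (double n ℕ.+ j)

  ∑paths-short : ∀ {y l} → l < y → ∑paths y l ≡ 0ℚ
  ∑paths-short {y} {l} l<y = cong (λ ps → ∑ ps statistic) (paths-short y l l<y)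

  ∑-paths-suc : ∀ y l (f : Path y (suc l) → ℚ) →
    ∑ (paths y (suc l)) f ≡ ∑ (paths (suc y) l) (f ∘ u∷_) + (∑ (pathsD y l) f + ∑ (pathsH y l) f)
  ∑-paths-suc y l f = trans
    (∑-++ (List.map u∷_ (paths (suc y) l)) (pathsD y l ++ pathsH y l) f)
    (cong₂ _+_ (∑-map u∷_ (paths (suc y) l) f) (∑-++ (pathsD y l) (pathsH y l) f))

  -- A first step from positive height changes neither `low` nor `hills`, so the statistic is that
  -- of the remaining path by computation.
  ∑paths-suc : ∀ y l → ∑paths (suc y) (suc l) ≡ ∑paths (2+ y) l + (∑paths y l + ∑paths-level (suc y) l)
  ∑paths-suc y l = trans (∑-paths-suc (suc y) l statistic)
    (cong (λ x → ∑paths (2+ y) l + (x + ∑paths-level (suc y) l)) (∑-map d∷_ (paths y l) statistic))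

  ∑paths-level-suc : ∀ y l → ∑paths-level (suc y) (suc l) ≡ ∑paths (suc y) l
  ∑paths-level-suc y l = ∑-map h∷_ (paths (suc y) l) statistic

  excursions-descending : Descending excursions
  excursions-descending = descending excursions e₀ e₊
    where
    level-short : ∀ j → ∑paths-level (suc j) j ≡ 0ℚ
    level-short zero    = refl
    level-short (suc j) = trans (∑paths-level-suc (suc j) j) (∑paths-short (ℕ.m≤n⇒m≤1+n (ℕ.n<1+n j)))

    -- A path as long as its height is high can only descend: after an up or a level step the rest
    -- is too short.
    e₀ : ∀ j → excursions (suc j) 0 ≡ excursions j 0
    e₀ j = begin
      ∑paths (suc j) (suc j)                                         ≡⟨ ∑paths-suc j j ⟩
      ∑paths (2+ j) j + (∑paths j j + ∑paths-level (suc j) j)        ≡⟨ cong₂ (λ x y → x + (∑paths j j + y)) (∑paths-short (ℕ.m≤n⇒m≤1+n (ℕ.n<1+n j))) (level-short j) ⟩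
      0ℚ + (∑paths j j + 0ℚ)                                         ≡⟨ ℚ.+-identityˡ (∑paths j j + 0ℚ) ⟩
      ∑paths j j + 0ℚ                                                ≡⟨ ℚ.+-identityʳ (∑paths j j) ⟩
      ∑paths j j                                                     ∎

    e₊ : ∀ j n → excursions (suc j) (suc n) ≡ excursions j (suc n) + (excursions (suc j) n + excursions (2+ j) n)
    e₊ j n = begin
      ∑paths (suc j) (2+ l)                                          ≡⟨ ∑paths-suc j (suc l) ⟩
      ∑paths (2+ j) (suc l) + (∑paths j (suc l) + ∑paths-level (suc j) (suc l))
        ≡⟨ cong₂ _+_ (cong (∑paths (2+ j)) (sym (ℕ.+-suc (double n) (suc j))))
             (cong₂ _+_ (cong (∑paths j ∘ suc) (ℕ.+-suc (double n) j)) (∑paths-level-suc j l)) ⟩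
      excursions (2+ j) n + (excursions j (suc n) + excursions (suc j) n)    ≡⟨ rotate (excursions (2+ j) n) (excursions j (suc n)) (excursions (suc j) n) ⟩
      excursions j (suc n) + (excursions (suc j) n + excursions (2+ j) n)    ∎
      where
      l = double n ℕ.+ suc j

      rotate : ∀ x y z → x + (y + z) ≡ y + (z + x)
      rotate = solve-∀ ℚ-ring

  ∑-𝒫 : ∀ n → ∑ (𝒫 n) statistic ≡ excursions 0 n
  ∑-𝒫 n = cong (∑paths 0) (2*n≡double n)

lowWeight : ℕ → ℕ → ℕ → ℚ
lowWeight c i _ = fromℕ (c ℕ.^ i)

lowSeries : ℕ → Series
lowSeries c = excursions (lowWeight c) 0

-- A nonempty path starts with a low `h`, contributing c, or with `u`, after which it is a path from
-- height 1, counted by `S-⋆`.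
lowSeries-equation : ∀ c → lowSeries c ≗ const 1ℚ ⊕ X ⋆ (S ⋆ lowSeries c ⊕ const (fromℕ c) ⋆ lowSeries c)
lowSeries-equation c zero    = sym (cong (1ℚ +_) (X⋆-zero (S ⋆ lowSeries c ⊕ const (fromℕ c) ⋆ lowSeries c)))
lowSeries-equation c (suc n) = begin
  ∑ (paths 0 (2+ l)) w                                                        ≡⟨ ∑-paths-suc g 0 (suc l) w ⟩
  ∑paths g 1 (suc l) + (0ℚ + ∑ (List.map h∷_ (paths 0 l)) w)                  ≡⟨ cong (∑paths g 1 (suc l) +_) (ℚ.+-identityˡ (∑ (List.map h∷_ (paths 0 l)) w)) ⟩
  ∑paths g 1 (suc l) + ∑ (List.map h∷_ (paths 0 l)) w                         ≡⟨ cong₂ _+_ (cong (∑paths g 1) (sym (ℕ.+-suc (double n) 0))) (∑-map h∷_ (paths 0 l) w) ⟩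
  excursions g 1 n + ∑ (paths 0 l) (λ p → fromℕ (c ℕ.* c ℕ.^ low p))          ≡⟨ cong₂ _+_ (S-⋆ (excursions g) (excursions-descending g) n) (trans
                                                                                   (∑-cong (paths 0 l) (λ p → fromℕ-* c (c ℕ.^ low p))) (∑-*ˡ (fromℕ c) (paths 0 l) w)) ⟩
  (S ⋆ lowSeries c) n + fromℕ c * lowSeries c n                               ≡⟨ cong ((S ⋆ lowSeries c) n +_) (const-⋆ (fromℕ c) (lowSeries c) n) ⟨
  (S ⋆ lowSeries c ⊕ const (fromℕ c) ⋆ lowSeries c) n                         ≡⟨ X⋆-suc (S ⋆ lowSeries c ⊕ const (fromℕ c) ⋆ lowSeries c) n ⟨
  (X ⋆ (S ⋆ lowSeries c ⊕ const (fromℕ c) ⋆ lowSeries c)) (suc n)             ≡⟨ ℚ.+-identityˡ _ ⟨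
  (const 1ℚ ⊕ X ⋆ (S ⋆ lowSeries c ⊕ const (fromℕ c) ⋆ lowSeries c)) (suc n)  ∎
  where
  l = double n ℕ.+ 0
  g = lowWeight c

  w : ∀ {y l} → Path y l → ℚ
  w = statistic g

∑-low : ∀ c n → fromℕ (sum (List.map (λ p → c ℕ.^ low p) (𝒫 n))) ≡ lowSeries c n
∑-low c n = trans (fromℕ-sum (λ p → c ℕ.^ low p) (𝒫 n)) (∑-𝒫 (lowWeight c) n)

-- The indicator of the paths counted by `A114710`, in the form of a weight to which the general
-- path recursion applies.
hillFree : ℕ → ℕ → ℚ
hillFree zero    zero    = 1ℚ
hillFree zero    (suc _) = 0ℚ
hillFree (suc _) _       = 0ℚ

hillFree-suc : ∀ i k → hillFree i (suc k) ≡ 0ℚ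
hillFree-suc zero    k = refl
hillFree-suc (suc i) k = refl

hillFreeSeries : Series
hillFreeSeries = excursions hillFree 0

∑-zero : ∀ {A : Set} (xs : List A) {f} → (∀ x → f x ≡ 0ℚ) → ∑ xs f ≡ 0ℚ
∑-zero []       e = refl
∑-zero (x ∷ xs) e = cong₂ _+_ (e x) (∑-zero xs e)

-- An initial low `h` is excluded. After an initial `u` the rest starts at height 1 but not with
-- `d`, which would close a hill; the excluded rests are paths from height 0 and account for the
-- subtracted series.
hillFreeSeries-equation : hillFreeSeries ≗ const 1ℚ ⊕ X ⋆ (S ⋆ hillFreeSeries ⊖ hillFreeSeries)
hillFreeSeries-equation zero    = sym (cong (1ℚ +_) (X⋆-zero (S ⋆ hillFreeSeries ⊖ hillFreeSeries)))
hillFreeSeries-equation (suc n) = begin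
  ∑ (paths 0 (2+ l)) w                                                     ≡⟨ ∑-paths-suc g 0 (suc l) w ⟩
  ∑ (paths 1 (suc l)) (w ∘ u∷_) + (0ℚ + ∑ (List.map h∷_ (paths 0 l)) w)
    ≡⟨ cong₂ (λ x y → x + (0ℚ + y)) (raised l) (trans (∑-map h∷_ (paths 0 l) w) (∑-zero (paths 0 l) (λ _ → refl))) ⟩
  ∑paths g 1 (suc l) + - ∑paths g 0 l + (0ℚ + 0ℚ)                          ≡⟨ ℚ.+-identityʳ (∑paths g 1 (suc l) + - ∑paths g 0 l) ⟩
  ∑paths g 1 (suc l) + - ∑paths g 0 l                                      ≡⟨ cong (λ m → ∑paths g 1 m + - ∑paths g 0 l) (ℕ.+-suc (double n) 0) ⟨
  excursions g 1 n + - hillFreeSeries n                                    ≡⟨ cong (_+ - hillFreeSeries n) (S-⋆ (excursions g) (excursions-descending g) n) ⟩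
  (S ⋆ hillFreeSeries ⊖ hillFreeSeries) n                                  ≡⟨ X⋆-suc (S ⋆ hillFreeSeries ⊖ hillFreeSeries) n ⟨
  (X ⋆ (S ⋆ hillFreeSeries ⊖ hillFreeSeries)) (suc n)                      ≡⟨ ℚ.+-identityˡ _ ⟨
  (const 1ℚ ⊕ X ⋆ (S ⋆ hillFreeSeries ⊖ hillFreeSeries)) (suc n)           ∎
  where
  l = double n ℕ.+ 0
  g = hillFree

  w : ∀ {y l} → Path y l → ℚ
  w = statistic g

  raised-level : ∀ l → ∑ (pathsH 1 l) (w ∘ u∷_) ≡ ∑paths-level g 1 l
  raised-level zero    = refl
  raised-level (suc l) = trans (∑-map h∷_ (paths 1 l) (w ∘ u∷_)) (sym (∑-map h∷_ (paths 1 l) w))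

  raised : ∀ l → ∑ (paths 1 (suc l)) (w ∘ u∷_) ≡ ∑paths g 1 (suc l) + - ∑paths g 0 l
  raised l = begin
    ∑ (paths 1 (suc l)) (w ∘ u∷_)                                         ≡⟨ ∑-paths-suc g 1 l (w ∘ u∷_) ⟩
    ∑paths g 2 l + (∑ (List.map d∷_ (paths 0 l)) (w ∘ u∷_) + ∑ (pathsH 1 l) (w ∘ u∷_))
      ≡⟨ cong₂ (λ x y → ∑paths g 2 l + (x + y)) (trans (∑-map d∷_ (paths 0 l) (w ∘ u∷_)) (∑-zero (paths 0 l) (λ p → hillFree-suc (low p) (hills p)))) (raised-level l) ⟩
    ∑paths g 2 l + (0ℚ + ∑paths-level g 1 l)                              ≡⟨ cancel (∑paths g 2 l) (∑paths-level g 1 l) (∑paths g 0 l) ⟩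
    ∑paths g 2 l + (∑paths g 0 l + ∑paths-level g 1 l) + - ∑paths g 0 l   ≡⟨ cong (_+ - ∑paths g 0 l) (∑paths-suc g 0 l) ⟨
    ∑paths g 1 (suc l) + - ∑paths g 0 l                                   ∎
    where
    cancel : ∀ x y z → x + (0ℚ + y) ≡ x + (z + y) + - z
    cancel = solve-∀ ℚ-ring

A114710≡hillFreeSeries : ∀ n → fromℕ (A114710 n) ≡ hillFreeSeries n
A114710≡hillFreeSeries n = begin
  fromℕ (length (filter P? (𝒫 n)))                ≡⟨ length-∑ (filter P? (𝒫 n)) ⟩
  ∑ (filter P? (𝒫 n)) (λ _ → 1ℚ)                  ≡⟨ ∑-filter P? (statistic hillFree) (λ { _ (p , q) → cong₂ hillFree p q }) (λ p → fails (low p) (hills p)) (𝒫 n) (λ _ → 1ℚ) ⟩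
  ∑ (𝒫 n) (λ p → statistic hillFree p * 1ℚ)       ≡⟨ ∑-cong (𝒫 n) (λ p → ℚ.*-identityʳ (statistic hillFree p)) ⟩
  ∑ (𝒫 n) (statistic hillFree)                    ≡⟨ ∑-𝒫 hillFree n ⟩
  hillFreeSeries n                                ∎
  where
  P? : ∀ {y l} (p : Path y l) → _
  P? p = (low p ℕ.≟ 0) ×-dec (hills p ℕ.≟ 0)

  length-∑ : ∀ {A : Set} (xs : List A) → fromℕ (length xs) ≡ ∑ xs (λ _ → 1ℚ)
  length-∑ []       = refl
  length-∑ (x ∷ xs) = trans (fromℕ-+ 1 (length xs)) (cong (1ℚ +_) (length-∑ xs))

  fails : ∀ i k → ¬ (i ≡ 0 × k ≡ 0) → hillFree i k ≡ 0ℚ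
  fails zero    zero    ¬p = contradiction (refl , refl) ¬p
  fails zero    (suc k) ¬p = refl
  fails (suc i) k       ¬p = refl

-- Identities between the series

-- The identities below are proved by exhibiting the difference of both sides as a combination of the relations
-- S = 1 + x (S + S²), 2 s = 1 + S and those of the path series.

Null : Series → Set
Null f = f ≗ λ _ → 0ℚ

⊖-null : ∀ {f g} → f ≗ g → Null (f ⊖ g)
⊖-null {g = g} f≗g n = trans (cong (_+ - g n) (f≗g n)) (ℚ.+-inverseʳ (g n))

⊕-null : ∀ {f g} → Null f → Null g → Null (f ⊕ g)
⊕-null f≗0 g≗0 n = cong₂ _+_ (f≗0 n) (g≗0 n)

⋆-null : ∀ f {g} → Null g → Null (f ⋆ g)
⋆-null f g≗0 n = trans (⋆-cong {f} (λ _ → refl) g≗0 n) (trans (⋆-comm f (λ _ → 0ℚ) n) (0-⋆ f n))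

drop-null : ∀ {f g h} → f ≗ g ⊕ h → Null h → f ≗ g
drop-null {g = g} f≗g+h h≗0 n = trans (f≗g+h n) (trans (cong (g n +_) (h≗0 n)) (ℚ.+-identityʳ (g n)))

≗-⋆ˡ : ∀ {a b} R D → a ≗ b → R ≗ b ⋆ D → R ≗ a ⋆ D
≗-⋆ˡ R D a≗b R≗b⋆D n = trans (R≗b⋆D n) (sym (⋆-cong {g = D} a≗b (λ _ → refl) n))

S-relation : Series
S-relation = S ⊖ (const 1ℚ ⊕ X ⋆ (S ⊕ S ⋆ S))

S-relation-null : Null S-relation
S-relation-null = ⊖-null S-equation

s-relation : Series
s-relation = s ⊖ const ½ ⋆ (const 1ℚ ⊕ S)

s-relation-null : Null s-relation
s-relation-null = ⊖-null s-equation

S≗2s-1 : S ≗ s ⊕ s ⊖ const 1ℚ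
S≗2s-1 = drop-null
  (series-solve 2 (λ S s → S := s :+ s :- con 1ℚ :+ con (- fromℕ 2) :* (s :- con ½ :* (con 1ℚ :+ S))) (λ _ → refl) S s)
  (⋆-null (const (- fromℕ 2)) s-relation-null)

-- Substitute 1 + S = 2 s in the equation of S, written as 1 + S = 2 + x S (1 + S), and halve.
s≗1+XSs : s ≗ const 1ℚ ⊕ X ⋆ (S ⋆ s)
s≗1+XSs = drop-null
  (series-solve 3 (λ x S s → s := con 1ℚ :+ x :* (S :* s) :+
      ((con 1ℚ :- x :* S) :* (s :- con ½ :* (con 1ℚ :+ S)) :+ con ½ :* (S :- (con 1ℚ :+ x :* (S :+ S :* S)))))
    (λ _ → refl) X S s)
  (⊕-null (⋆-null (const 1ℚ ⊖ X ⋆ S) s-relation-null) (⋆-null (const ½) S-relation-null))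

S-shift : S ∘ suc ≗ S ⊕ S ⋆ S
S-shift n = trans (S-equation (suc n)) (trans (ℚ.+-identityˡ _) (X⋆-suc (S ⊕ S ⋆ S) n))

s-shift : s ∘ suc ≗ S ⋆ s
s-shift n = trans (s≗1+XSs (suc n)) (trans (ℚ.+-identityˡ _) (X⋆-suc (S ⋆ s) n))

-- Multiply s = 1 + x S s by 2 + S and replace 2 s by 1 + S. This form exposes the second shift of
-- s.
Ss≗1+XSs[2+S] : S ⋆ s ≗ const 1ℚ ⊕ X ⋆ (S ⋆ s ⋆ (const (fromℕ 2) ⊕ S))
Ss≗1+XSs[2+S] = drop-null
  (series-solve 3 (λ x S s → S :* s := con 1ℚ :+ x :* (S :* s :* (con (fromℕ 2) :+ S)) :+
      ((S :- (s :+ s :- con 1ℚ)) :+ (con (fromℕ 2) :+ S) :* (s :- (con 1ℚ :+ x :* (S :* s)))))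
    (λ _ → refl) X S s)
  (⊕-null (⊖-null S≗2s-1) (⋆-null (const (fromℕ 2) ⊕ S) (⊖-null s≗1+XSs)))

s-shift² : s ∘ suc ∘ suc ≗ S ⋆ s ⋆ (const (fromℕ 2) ⊕ S)
s-shift² n = trans (s-shift (suc n)) (trans (Ss≗1+XSs[2+S] (suc n))
  (trans (ℚ.+-identityˡ _) (X⋆-suc (S ⋆ s ⋆ (const (fromℕ 2) ⊕ S)) n)))

-- R is 1 + S because index 0 belongs to n = 1, where the sum is S₁ = 2. As S = 1 + x S (1 + S), the
-- factor 1 - x (1 + S) is the inverse of S.
signed-S₁ : const 1ℚ ⊕ S ≗ (S ∘ suc) ⋆ (const 1ℚ ⊖ X ⋆ (const 1ℚ ⊕ S))
signed-S₁ = ≗-⋆ˡ (const 1ℚ ⊕ S) (const 1ℚ ⊖ X ⋆ (const 1ℚ ⊕ S)) S-shift (drop-null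
    (series-solve 2 (λ x S → con 1ℚ :+ S := (S :+ S :* S) :* (con 1ℚ :- x :* (con 1ℚ :+ S)) :+
        :- (con 1ℚ :+ S) :* (S :- (con 1ℚ :+ x :* (S :+ S :* S))))
      (λ _ → refl) X S)
    (⋆-null (⊝ (const 1ℚ ⊕ S)) S-relation-null))

-- With x (S + S²) = S - 1 the claim is 2 G (2 - S) = S + S² for G = `lowSeries 4`. Multiplied by 1
-- - x (S + 4), the inverse of G, both sides are 4 - 2 S.
unsigned-S₁ : const (fromℕ 2) ⋆ lowSeries 4 ≗ (S ∘ suc) ⋆ (const 1ℚ ⊕ X ⋆ (const (fromℕ 2) ⋆ lowSeries 4))
unsigned-S₁ = ≗-⋆ˡ (const (fromℕ 2) ⋆ lowSeries 4) (const 1ℚ ⊕ X ⋆ (const (fromℕ 2) ⋆ lowSeries 4)) S-shift (drop-null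
    (series-solve 3 (λ x S G → con (fromℕ 2) :* G := (S :+ S :* S) :* (con 1ℚ :+ x :* (con (fromℕ 2) :* G)) :+
        ((S :+ S :* S) :* (G :- (con 1ℚ :+ x :* (S :* G :+ con (fromℕ 4) :* G))) :+
         :- (G :* (con (fromℕ 2) :+ S)) :* (S :- (con 1ℚ :+ x :* (S :+ S :* S)))))
      (λ _ → refl) X S (lowSeries 4))
    (⊕-null (⋆-null (S ⊕ S ⋆ S) (⊖-null (lowSeries-equation 4)))
      (⋆-null (⊝ (lowSeries 4 ⋆ (const (fromℕ 2) ⊕ S))) S-relation-null)))

signed-S₀ : s ≗ S ⋆ (const 1ℚ ⊖ X ⋆ s)
signed-S₀ = drop-null
  (series-solve 3 (λ x S s → s := S :* (con 1ℚ :- x :* s) :+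
      (con (- 1ℚ) :* (S :- (s :+ s :- con 1ℚ)) :+ con (- 1ℚ) :* (s :- (con 1ℚ :+ x :* (S :* s)))))
    (λ _ → refl) X S s)
  (⊕-null (⋆-null (const (- 1ℚ)) (⊖-null S≗2s-1)) (⋆-null (const (- 1ℚ)) (⊖-null s≗1+XSs)))

unsigned-S₀ : s ∘ suc ≗ S ⋆ (const 1ℚ ⊕ X ⋆ (s ∘ suc))
unsigned-S₀ n = trans (s-shift n) (⋆-cong {S} (λ _ → refl) s≗ n)
  where
  s≗ : s ≗ const 1ℚ ⊕ X ⋆ (s ∘ suc)
  s≗ k = trans (s≗1+XSs k) (cong (const 1ℚ k +_) (⋆-cong {X} (λ _ → refl) (λ m → sym (s-shift m)) k))

-- By its equation, s is the inverse of 1 - x S.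
signed-s₁ : S ≗ (s ∘ suc) ⋆ (const 1ℚ ⊖ X ⋆ S)
signed-s₁ = ≗-⋆ˡ S (const 1ℚ ⊖ X ⋆ S) s-shift (drop-null
    (series-solve 3 (λ x S s → S := S :* s :* (con 1ℚ :- x :* S) :+ (:- S) :* (s :- (con 1ℚ :+ x :* (S :* s))))
      (λ _ → refl) X S s)
    (⋆-null (⊝ S) (⊖-null s≗1+XSs)))

-- With x S s = s - 1 the claim is G (2 - s) = S s for G = `lowSeries 3`. Multiplied by 1 - x (S +
-- 3), the inverse of G, both sides are 2 - s.
unsigned-s₁ : lowSeries 3 ≗ (s ∘ suc) ⋆ (const 1ℚ ⊕ X ⋆ lowSeries 3)
unsigned-s₁ = ≗-⋆ˡ (lowSeries 3) (const 1ℚ ⊕ X ⋆ lowSeries 3) s-shift (drop-null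
    (series-solve 4 (λ x S s G → G := S :* s :* (con 1ℚ :+ x :* G) :+
        (S :* s :* (G :- (con 1ℚ :+ x :* (S :* G :+ con (fromℕ 3) :* G))) :+
         (:- G :* (S :- (s :+ s :- con 1ℚ)) :+
          :- (G :* (con (fromℕ 2) :+ S)) :* (s :- (con 1ℚ :+ x :* (S :* s))))))
      (λ _ → refl) X S s (lowSeries 3))
    (⊕-null (⋆-null (S ⋆ s) (⊖-null (lowSeries-equation 3)))
      (⊕-null (⋆-null (⊝ lowSeries 3) (⊖-null S≗2s-1)) (⋆-null (⊝ (lowSeries 3 ⋆ (const (fromℕ 2) ⊕ S))) (⊖-null s≗1+XSs)))))

-- The inverse of `hillFreeSeries` is 1 - x S + x, and s times this is 1 + x s because s (1 - x S) =
-- 1.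
signed-s₀ : hillFreeSeries ≗ s ⋆ (const 1ℚ ⊖ X ⋆ hillFreeSeries)
signed-s₀ = drop-null
  (series-solve 4 (λ x S s H → H := s :* (con 1ℚ :- x :* H) :+
      (s :* (H :- (con 1ℚ :+ x :* (S :* H :- H))) :+ :- H :* (s :- (con 1ℚ :+ x :* (S :* s)))))
    (λ _ → refl) X S s hillFreeSeries)
  (⊕-null (⋆-null s (⊖-null hillFreeSeries-equation)) (⋆-null (⊝ hillFreeSeries) (⊖-null s≗1+XSs)))

unsigned-s₀ : S ≗ s ⋆ (const 1ℚ ⊕ X ⋆ S)
unsigned-s₀ = drop-null
  (series-solve 3 (λ x S s → S := s :* (con 1ℚ :+ x :* S) :+
      ((S :- (s :+ s :- con 1ℚ)) :+ (s :- (con 1ℚ :+ x :* (S :* s)))))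
    (λ _ → refl) X S s)
  (⊕-null (⊖-null S≗2s-1) (⊖-null s≗1+XSs))

-- The constant 2 adjusts index 0, where the sum is s₂ = 3 and not S₀. The factor 1 - x (2 + S) is
-- the inverse of S s.
signed-s₂ : const (fromℕ 2) ⊕ S ≗ (s ∘ suc ∘ suc) ⋆ (const 1ℚ ⊖ X ⋆ (const (fromℕ 2) ⊕ S))
signed-s₂ = ≗-⋆ˡ (const (fromℕ 2) ⊕ S) (const 1ℚ ⊖ X ⋆ (const (fromℕ 2) ⊕ S)) s-shift² (drop-null
    (series-solve 3 (λ x S s → con (fromℕ 2) :+ S := S :* s :* (con (fromℕ 2) :+ S) :* (con 1ℚ :- x :* (con (fromℕ 2) :+ S)) :+
        :- (con (fromℕ 2) :+ S) :* (S :* s :- (con 1ℚ :+ x :* (S :* s :* (con (fromℕ 2) :+ S)))))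
      (λ _ → refl) X S s)
    (⋆-null (⊝ (const (fromℕ 2) ⊕ S)) (⊖-null Ss≗1+XSs[2+S])))

theorem4 : (∀ n → n ≥ 2 → (∑[weight≡ n ] λ v → sign v * multinomial v * powersFrom 1 S v) ≡ S (n ∸ 1))
    × (∀ n → n ≥ 1 → (∑[weight≡ n ] λ v → multinomial v * powersFrom 1 S v) ≡ fromℕ 2 * fromℕ (A134425 (n ∸ 1)))
    × (∀ n → n ≥ 1 → (∑[weight≡ n ] λ v → sign v * multinomial v * powersFrom 0 S v) ≡ s (n ∸ 1))
    × (∀ n → n ≥ 1 → (∑[weight≡ n ] λ v → multinomial v * powersFrom 0 S v) ≡ s n)
    × (∀ n → n ≥ 1 → (∑[weight≡ n ] λ v → sign v * multinomial v * powersFrom 1 s v) ≡ S (n ∸ 1))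
    × (∀ n → n ≥ 1 → (∑[weight≡ n ] λ v → multinomial v * powersFrom 1 s v) ≡ fromℕ (A225887 (n ∸ 1)))
    × (∀ n → n ≥ 1 → (∑[weight≡ n ] λ v → sign v * multinomial v * powersFrom 0 s v) ≡ fromℕ (A114710 (n ∸ 1)))
    × (∀ n → n ≥ 1 → (∑[weight≡ n ] λ v → multinomial v * powersFrom 0 s v) ≡ S (n ∸ 1))
    × (∀ n → n ≥ 2 → (∑[weight≡ n ] λ v → sign v * multinomial v * powersFrom 2 s v) ≡ S (n ∸ 1))
theorem4 =
    -- Weight n + 2 reads off coefficient n + 1, where the constant added to S contributes 0; this
    -- is the reason for n ≥ 2.
    (λ { (suc (suc n)) _ → trans (signedSum 1 S (const 1ℚ ⊕ S) signed-S₁ (suc n)) (ℚ.+-identityˡ (S (suc n))) ; (suc zero) (s≤s ()) })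
  , (λ { (suc n) _ → trans (unsignedSum 1 S (const (fromℕ 2) ⋆ lowSeries 4) unsigned-S₁ n)
           (trans (const-⋆ (fromℕ 2) (lowSeries 4) n) (cong (fromℕ 2 *_) (sym (∑-low 4 n)))) })
  , (λ { (suc n) _ → signedSum 0 S s signed-S₀ n })
  , (λ { (suc n) _ → unsignedSum 0 S (s ∘ suc) unsigned-S₀ n })
  , (λ { (suc n) _ → signedSum 1 s S signed-s₁ n })
  , (λ { (suc n) _ → trans (unsignedSum 1 s (lowSeries 3) unsigned-s₁ n) (sym (∑-low 3 n)) })
  , (λ { (suc n) _ → trans (signedSum 0 s hillFreeSeries signed-s₀ n) (sym (A114710≡hillFreeSeries n)) })
  , (λ { (suc n) _ → unsignedSum 0 s S unsigned-s₀ n })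
  , (λ { (suc (suc n)) _ → trans (signedSum 2 s (const (fromℕ 2) ⊕ S) signed-s₂ (suc n)) (ℚ.+-identityˡ (S (suc n))) ; (suc zero) (s≤s ()) })
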